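{- Let $\varepsilon, \alpha > 0$ be real numbers with $\varepsilon < \frac{\alpha}{2}$. Let $G$ be a graph with maximum degree $\Delta(G)$ and clique number $\omega(G)$. If $G$ is $L$-critical with respect to some $\lceil (1-\varepsilon)(\Delta(G)+1)\rceil$-list-assignment $L$ and $\omega(G) \leq (1-\alpha)(\Delta(G)+1)$, then $G$ is $\frac{(\alpha-2\varepsilon)^2}{2}$-sparse.
   Context: A list assignment $L$ of a graph $G$ assigns to each vertex $v$ a nonempty set $L(v)$ of colours; it is a $k$-list-assignment if $|L(v)|\ge k$ for all $v$. An $L$-colouring is a proper colouring $\phi$ with $\phi(v)\in L(v)$ for all $v$. $G$ is $L$-critical if $G$ has no $L$-colouring but every proper subgraph of $G$ has one (with respect to the restriction of $L$). For $\delta\ge 0$, a graph $G$ of maximum degree $\Delta$ is $\delta$-sparse if for every vertex $v$ the subgraph induced by the neighbourhood $N(v)$ has at most $(1-\delta)\binom{\Delta}{2}$ edges. -}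

module Defs where

open import Data.Nat as ℕ using (ℕ; zero; suc; _<ᵇ_; _⊔_)
open import Data.Nat.Combinatorics using (_C_)
open import Data.Fin using (Fin; toℕ) renaming (zero to fzero; suc to fsuc)
open import Data.Bool using (Bool; true; false; if_then_else_; _∧_)
open import Data.List using (List; []; length)
open import Data.List.Relation.Unary.Unique.Propositional using (Unique)
open import Data.List.Membership.Propositional using (_∈_)
open import Data.Product using (Σ; ∃; _×_; _,_)
open import Data.Sum using (_⊎_)
open import Relation.Binary.PropositionalEquality using (_≡_; _≢_)
open import Relation.Nullary using (¬_)

-- The real numbers, axiomatised as a complete ordered field
-- (every model is isomorphic to ℝ).  Equality is propositional.

record RealField : Set₁ where
  infixl 6 _+_
  infixl 7 _*_
  infix  4 _≤_
  field
    ℝ    : Set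
    0r 1r : ℝ
    _+_ _*_ : ℝ → ℝ → ℝ
    -_   : ℝ → ℝ
    _≤_  : ℝ → ℝ → Set
    +-assoc   : ∀ x y z → (x + y) + z ≡ x + (y + z)
    +-comm    : ∀ x y → x + y ≡ y + x
    +-idˡ     : ∀ x → 0r + x ≡ x
    +-invˡ    : ∀ x → (- x) + x ≡ 0r
    *-assoc   : ∀ x y z → (x * y) * z ≡ x * (y * z)
    *-comm    : ∀ x y → x * y ≡ y * x
    *-idˡ     : ∀ x → 1r * x ≡ x
    distribˡ  : ∀ x y z → x * (y + z) ≡ x * y + x * z
    0≢1       : 0r ≢ 1r
    *-inv     : ∀ x → x ≢ 0r → ∃ λ y → x * y ≡ 1r
    ≤-refl    : ∀ x → x ≤ x
    ≤-antisym : ∀ {x y} → x ≤ y → y ≤ x → x ≡ y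
    ≤-trans   : ∀ {x y z} → x ≤ y → y ≤ z → x ≤ z
    ≤-total   : ∀ x y → x ≤ y ⊎ y ≤ x
    +-mono-≤  : ∀ {x y} z → x ≤ y → x + z ≤ y + z
    *-nonneg  : ∀ {x y} → 0r ≤ x → 0r ≤ y → 0r ≤ x * y
    sup : (P : ℝ → Set) → (∃ λ x → P x) → (∃ λ b → ∀ x → P x → x ≤ b) →
          ∃ λ s → (∀ x → P x → x ≤ s) × (∀ b → (∀ x → P x → x ≤ b) → s ≤ b)

  infixl 6 _-_
  infix  4 _<_
  _-_ : ℝ → ℝ → ℝ
  x - y = x + (- y)

  _<_ : ℝ → ℝ → Set
  x < y = x ≤ y × x ≢ y

  ι : ℕ → ℝ
  ι zero    = 0r
  ι (suc n) = 1r + ι n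

  -- k is the ceiling of x, for k ranging over ℕ
  -- (if x ≤ 0 this gives k = 0, which yields the same k-list-assignment
  --  condition as the integer ceiling, since list sizes are ≥ 0)
  IsCeil : ℕ → ℝ → Set
  IsCeil k x = x ≤ ι k × (∀ m → x ≤ ι m → k ℕ.≤ m)

record Graph (n : ℕ) : Set where
  field
    adj    : Fin n → Fin n → Bool
    sym    : ∀ u v → adj u v ≡ adj v u
    irrefl : ∀ v → adj v v ≡ false
open Graph public

count : ∀ {n} → (Fin n → Bool) → ℕ
count {zero}  f = 0
count {suc n} f = (if f fzero then 1 else 0) ℕ.+ count (λ i → f (fsuc i))

maxOver : ∀ {n} → (Fin n → ℕ) → ℕ
maxOver {zero}  f = 0
maxOver {suc n} f = f fzero ⊔ maxOver (λ i → f (fsuc i))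

degree : ∀ {n} → Graph n → Fin n → ℕ
degree G v = count (adj G v)

maxDegree : ∀ {n} → Graph n → ℕ
maxDegree G = maxOver (degree G)

IsClique : ∀ {n} → Graph n → (Fin n → Bool) → Set
IsClique G S = ∀ u v → S u ≡ true → S v ≡ true → u ≢ v → adj G u v ≡ true

IsCliqueNumber : ∀ {n} → Graph n → ℕ → Set
IsCliqueNumber G w =
  (∃ λ S → IsClique G S × count S ≡ w) × (∀ S → IsClique G S → count S ℕ.≤ w)

nbhdEdges : ∀ {n} → Graph n → Fin n → ℕ
nbhdEdges G v =
  sumOver (λ u → count (λ w → (toℕ u <ᵇ toℕ w) ∧ adj G v u ∧ adj G v w ∧ adj G u w))
  where
  sumOver : ∀ {m} → (Fin m → ℕ) → ℕ
  sumOver {zero}  f = 0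
  sumOver {suc m} f = f fzero ℕ.+ sumOver (λ i → f (fsuc i))

Sparse : (R : RealField) → ∀ {n} → Graph n → RealField.ℝ R → Set
Sparse R G δ = ∀ v → ι (nbhdEdges G v) ≤ (1r - δ) * ι (maxDegree G C 2)
  where open RealField R

-- List assignments and colourings (colours are natural numbers;
-- a finite colour set is a duplicate-free list)

ListAssignment : ℕ → Set
ListAssignment n = Fin n → List ℕ

IsListAssignment : ∀ {n} → ListAssignment n → Set
IsListAssignment L = ∀ v → Unique (L v) × L v ≢ []

IsKListAssignment : ∀ {n} → ListAssignment n → ℕ → Set
IsKListAssignment L k = IsListAssignment L × (∀ v → k ℕ.≤ length (L v))

record Subgraph {n} (G : Graph n) : Set where
  field
    keepV : Fin n → Bool
    keepE : Fin n → Fin n → Bool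
    keepE-sym : ∀ u v → keepE u v ≡ keepE v u
    keepE-ok  : ∀ u v → keepE u v ≡ true →
                adj G u v ≡ true × keepV u ≡ true × keepV v ≡ true
open Subgraph public

IsProper : ∀ {n} {G : Graph n} → Subgraph G → Set
IsProper {G = G} H =
  (∃ λ v → keepV H v ≡ false) ⊎
  (∃ λ u → ∃ λ v → adj G u v ≡ true × keepE H u v ≡ false)

SubColourable : ∀ {n} {G : Graph n} → ListAssignment n → Subgraph G → Set
SubColourable L H = ∃ λ (φ : Fin _ → ℕ) →
  (∀ v → keepV H v ≡ true → φ v ∈ L v) ×
  (∀ u v → keepE H u v ≡ true → φ u ≢ φ v)

Colourable : ∀ {n} → Graph n → ListAssignment n → Set
Colourable G L = ∃ λ (φ : Fin _ → ℕ) →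
  (∀ v → φ v ∈ L v) × (∀ u v → adj G u v ≡ true → φ u ≢ φ v)

IsCritical : ∀ {n} → Graph n → ListAssignment n → Set
IsCritical G L = ¬ Colourable G L ×
  (∀ (H : Subgraph G) → IsProper H → SubColourable L H)

{-# OPTIONS --safe #-}

-- Let N = Δ + 1, s = N − k ≤ ε N, and let ω be the clique number.  Take a non-empty set H of
-- vertices and a maximal matching of non-adjacent pairs in H.  Its unmatched vertices form a
-- clique, so H splits into r ≤ (|H| + ω) / 2 parts: independent pairs and single vertices.
-- Colour G − H by criticality; a vertex u of H keeps at least |H| − s − m(u) colours, where
-- m(u) counts the non-neighbours of u in H other than u.  If every vertex kept r colours, then
-- the Erdős–Rubin–Taylor theorem on complete multipartite graphs with parts of size at most
-- two would colour H.  Hence some u has m(u) > (|H| − ω) / 2 − s.  Deleting such vertices one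
-- at a time shows that H spans at least t² / 4 non-edges, where t = |H| − ω − 2 s.  For
-- H = N[v] and deg v = Δ we have t ≥ (α − 2 ε) N, which is the claim; if deg v < Δ, then the
-- pairs counted by C(Δ, 2) but not by C(deg v, 2) make up for the smaller t.
module Submission where

open import Defs hiding (sym)
open import Algebra.Bundles using (CommutativeSemiring)
import Algebra.Solver.Ring.NaturalCoefficients.Default as SemiringSolver
open import Data.Nat using (ℕ; zero; suc)
import Data.Nat as ℕ
open import Data.Nat.Combinatorics using (_C_; nC1≡n; nCk+nC[k+1]≡[n+1]C[k+1]; k>n⇒nCk≡0)
import Data.Nat.Properties as ℕ
open import Data.Product using (∃; _×_; _,_; proj₁; proj₂)
open import Data.Sum using (_⊎_; inj₁; inj₂)
open import Relation.Binary.Bundles using (Poset)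
open import Relation.Binary.PropositionalEquality using (_≡_; refl; sym; trans; cong; cong₂; subst; subst₂; isEquivalence; module ≡-Reasoning)
import Relation.Binary.Reasoning.PartialOrder as PosetReasoning
open import Relation.Nullary using (yes; no; contradiction)

module Combinatorics where

  open import Data.Bool using (Bool; true; false; not; _∧_; if_then_else_)
  import Data.Bool as Bool
  open import Data.Bool.Properties using (∧-comm)
  open import Data.Empty using (⊥; ⊥-elim)
  open import Data.Fin using (Fin; toℕ) renaming (zero to fzero; suc to fsuc)
  import Data.Fin as Fin
  open import Data.Fin.Properties using (all?)
  open import Data.Fin.Subset.Properties using (anySubset?)
  open import Data.List using (List; []; _∷_; _++_; length; map; filter; tabulate; allFin)
  open import Data.List.Properties using (length-map; length-++; ++-identityʳ; filter-accept; filter-none)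
  open import Data.List.Membership.Propositional using (_∈_; _∉_; find; lose)
  open import Data.List.Membership.Propositional.Properties
  open import Data.List.Relation.Binary.Permutation.Propositional using (_↭_; ↭⇒↭ₛ; ↭-sym; ↭-trans; ↭-refl; prep; swap) renaming (refl to ↭refl; trans to ↭trans)
  open import Data.List.Relation.Binary.Permutation.Propositional.Properties using (shift; ∈-resp-↭; ↭-length; filter-↭; ++⁺ˡ)
  import Data.List.Relation.Binary.Permutation.Setoid.Properties as Permutationₛ
  open import Data.List.Relation.Binary.Subset.Propositional using (_⊆_)
  open import Data.List.Relation.Unary.All as All using ([]; _∷_)
  open import Data.List.Relation.Unary.AllPairs using (AllPairs; []; _∷_)
  open import Data.List.Relation.Unary.Any using (here; there; any?)
  open import Data.List.Relation.Unary.Unique.Propositional using (Unique)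
  open import Data.List.Relation.Unary.Unique.Propositional.Properties as Uniq using (Unique[x∷xs]⇒x∉xs)
  open import Data.Nat using (_+_; _*_; _≤_; _<_; _≤?_; _<ᵇ_; z≤n; s≤s)
  open import Data.Nat.Properties
  open import Data.Nat.Tactic.RingSolver using (solve-∀)
  import Data.Sum as Sum
  open import Data.Vec as Vec using (lookup)
  open import Data.Vec.Properties using (lookup∘tabulate)
  open import Function using (_∘_; id)
  open import Relation.Binary.Definitions using (DecidableEquality; Symmetric) renaming (Decidable to Decidable₂)
  open import Relation.Binary.PropositionalEquality using (_≢_; ≢-sym; setoid)
  open import Relation.Nullary using (¬_; Dec; does; _→-dec_; _×-dec_; ¬?)
  open import Relation.Nullary.Decidable using (dec-true; dec-false; decidable-stable)
  open import Relation.Unary using (Decidable)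
  open import Algebra.Properties.CommutativeSemigroup +-commutativeSemigroup using (x∙yz≈y∙xz)

  -- Duplicate-free lists, permutations and the pigeonhole principle.

  module _ {A : Set} where

    AllPairs-resp-↭ : ∀ {R : A → A → Set} → Symmetric R →
      ∀ {xs ys} → xs ↭ ys → AllPairs R xs → AllPairs R ys
    AllPairs-resp-↭ s p = Permutationₛ.AllPairs-resp-↭ (setoid A) s
      ((λ { refl r → r }) , (λ { refl r → r })) (↭⇒↭ₛ p)

    ∈⇒↭∷ : ∀ {x : A} {xs} → x ∈ xs → ∃ λ ys → xs ↭ x ∷ ys
    ∈⇒↭∷ x∈xs with ys , zs , refl ← ∈-∃++ x∈xs = ys ++ zs , shift _ ys zs

    Unique⇒length≤ : ∀ {xs ys : List A} → Unique xs → xs ⊆ ys → length xs ≤ length ys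
    Unique⇒length≤ [] _ = z≤n
    Unique⇒length≤ {x ∷ xs} (x∉ ∷ u) xs⊆ys with ∈⇒↭∷ (xs⊆ys (here refl))
    ... | ys′ , p = ≤-trans (s≤s (Unique⇒length≤ u xs⊆ys′)) (≤-reflexive (sym (↭-length p)))
      where
      xs⊆ys′ : xs ⊆ ys′
      xs⊆ys′ z∈xs with ∈-resp-↭ p (xs⊆ys (there z∈xs))
      ... | here refl = contradiction refl (All.lookup x∉ z∈xs)
      ... | there z∈ys′ = z∈ys′

    module _ {P : A → Set} (P? : Decidable P) where

      length-filter-complement : ∀ xs →
        length (filter P? xs) + length (filter (¬? ∘ P?) xs) ≡ length xs
      length-filter-complement [] = refl
      length-filter-complement (x ∷ xs) with P? x
      ... | yes _ = cong suc (length-filter-complement xs)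
      ... | no  _ = trans (+-suc _ _) (cong suc (length-filter-complement xs))

  module _ {A : Set} (_≟_ : DecidableEquality A) where

    open import Data.List.Membership.DecPropositional _≟_ using (_∈?_)

    -- The discarded entries form a duplicate-free list inside `ys`, so there are at most
    -- `length ys` of them.
    length-without : ∀ {xs : List A} ys → Unique xs →
      length xs ≤ length (filter (λ x → ¬? (x ∈? ys)) xs) + length ys
    length-without {xs} ys u = begin
      length xs
        ≡⟨ length-filter-complement (_∈? ys) xs ⟨
      length (filter (_∈? ys) xs) + length (filter (λ x → ¬? (x ∈? ys)) xs)
        ≤⟨ +-monoˡ-≤ _ (Unique⇒length≤ (Uniq.filter⁺ (_∈? ys) u) (proj₂ ∘ ∈-filter⁻ (_∈? ys) {xs = xs})) ⟩
      length ys + length (filter (λ x → ¬? (x ∈? ys)) xs)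
        ≡⟨ +-comm (length ys) _ ⟩
      length (filter (λ x → ¬? (x ∈? ys)) xs) + length ys ∎
      where open ≤-Reasoning

  -- Hall's theorem by alternating paths.

  module Colouring {A : Set} (_≟_ : DecidableEquality A) where

    open import Data.List.Membership.DecPropositional _≟_ using (_∈?_)
    open import Data.List.Membership.DecPropositional ℕ._≟_ using () renaming (_∈?_ to _∈ᶜ?_)

    _[_↦_] : (A → ℕ) → A → ℕ → A → ℕ
    (φ [ z ↦ c ]) u with u ≟ z
    ... | yes _ = c
    ... | no  _ = φ u

    update-≡ : ∀ φ {z c u} → u ≡ z → (φ [ z ↦ c ]) u ≡ c
    update-≡ φ {z} {u = u} u≡z with u ≟ z
    ... | yes _ = refl
    ... | no u≢z = contradiction u≡z u≢z

    update-≢ : ∀ φ {z c u} → u ≢ z → (φ [ z ↦ c ]) u ≡ φ u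
    update-≢ φ {z} {u = u} u≢z with u ≟ z
    ... | yes u≡z = contradiction u≡z u≢z
    ... | no _ = refl

    -- A system of distinct representatives. The choice is a total function constrained only on `P`,
    -- so recolouring one vertex is an update and partial systems need no type of their own.
    record Represents (L : A → List ℕ) (P : A → Set) (φ : A → ℕ) : Set where
      field
        chosen    : ∀ {u} → P u → φ u ∈ L u
        injective : ∀ {u w} → P u → P w → φ u ≡ φ w → u ≡ w
    open Represents

    -- The obstruction in Hall's theorem. Repetitions in `colours` are allowed, since they only make
    -- `deficit` harder to satisfy.
    record HallViolator (L : A → List ℕ) (vs : List A) : Set where
      field
        members  : List A
        colours  : List ℕ
        unique   : Unique members
        included : members ⊆ vs
        covered  : ∀ {u} → u ∈ members → L u ⊆ colours
        deficit  : length colours < length members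

    module _ {L : A → List ℕ} where

      represents-update : ∀ {P Q : A → Set} {φ z c} → Represents L P φ → c ∈ L z →
        (∀ {u} → Q u → u ≢ z → P u × φ u ≢ c) → Represents L Q (φ [ z ↦ c ])
      represents-update {P} {Q} {φ} {z} {c} rep c∈Lz Q⇒P = record { chosen = ch ; injective = inj }
        where
        ch : ∀ {u} → Q u → (φ [ z ↦ c ]) u ∈ L u
        ch {u} qu with u ≟ z
        ... | yes refl = c∈Lz
        ... | no u≢z = chosen rep (proj₁ (Q⇒P qu u≢z))
        inj : ∀ {u w} → Q u → Q w → (φ [ z ↦ c ]) u ≡ (φ [ z ↦ c ]) w → u ≡ w
        inj {u} {w} qu qw eq with u ≟ z | w ≟ z
        ... | yes refl | yes refl = refl
        ... | yes refl | no w≢z = contradiction (sym eq) (proj₂ (Q⇒P qw w≢z))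
        ... | no u≢z | yes refl = contradiction eq (proj₂ (Q⇒P qu u≢z))
        ... | no u≢z | no w≢z = injective rep (proj₁ (Q⇒P qu u≢z)) (proj₁ (Q⇒P qw w≢z)) eq

      -- One augmentation: φ represents vs, and Z collects the vertices reached from v by
      -- alternating paths, so each z in v ∷ Z can be made the unrepresented one.
      module Augment {v vs φ} (uniq : Unique (v ∷ vs)) (rep : Represents L (_∈ vs) φ) where

        Others : A → A → Set
        Others z u = u ∈ v ∷ vs × u ≢ z

        -- The outcome of shifting colours along an alternating path that ends in `z`. The invariant
        -- is `recoloured`: each colour in use is a colour of `Z` or still sits where `φ` put it.
        -- Hence a colour outside `map φ Z` can clash only with its owner under `φ`.
        record Freed (Z : List A) (z : A) : Set where
          field
            ψ          : A → ℕ
            represents : Represents L (Others z) ψ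
            recoloured : ∀ {u} → Others z u → ψ u ∈ map φ Z ⊎ (u ∈ vs × ψ u ≡ φ u)

        weaken : ∀ {Z z} w → Freed Z z → Freed (w ∷ Z) z
        weaken {Z} {z} w F = record
          { ψ = Freed.ψ F
          ; represents = Freed.represents F
          ; recoloured = λ m → Sum.map₁ there (Freed.recoloured F m)
          }

        augment : ∀ k Z → length vs < length Z + k → Unique Z → Z ⊆ vs →
          (∀ {z} → z ∈ v ∷ Z → Freed Z z) →
          (∃ λ χ → Represents L (_∈ v ∷ vs) χ) ⊎ HallViolator L (v ∷ vs)
        augment zero Z big uZ Z⊆vs _ =
          contradiction (Unique⇒length≤ uZ Z⊆vs) (<⇒≱ (subst (length vs <_) (+-identityʳ _) big))
        augment (suc k) Z big uZ Z⊆vs freed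
          with any? (λ z → any? (λ c → ¬? (c ∈ᶜ? map φ Z)) (L z)) (v ∷ Z)
        ... | no none = inj₂ record
          { members = v ∷ Z
          ; colours = map φ Z
          ; unique = All.tabulate (λ { z∈Z refl → Unique[x∷xs]⇒x∉xs uniq (Z⊆vs z∈Z) }) ∷ uZ
          ; included = λ { (here p) → here p ; (there z∈Z) → there (Z⊆vs z∈Z) }
          ; covered = λ {z} z∈S {c} c∈Lz →
              decidable-stable (c ∈ᶜ? map φ Z) (λ c∉ → none (lose z∈S (lose c∈Lz c∉)))
          ; deficit = s≤s (≤-reflexive (length-map φ Z))
          }
        ... | yes found
          with z , z∈S , found′ ← find found
          with c , c∈Lz , c∉ ← find found′
          with c ∈ᶜ? map φ vs
        ... | no c-free = inj₁ (Freed.ψ F [ z ↦ c ] ,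
              represents-update (Freed.represents F) c∈Lz (λ u∈ u≢z → (u∈ , u≢z) , fresh (u∈ , u≢z)))
          where
          F = freed z∈S
          fresh : ∀ {u} → Others z u → Freed.ψ F u ≢ c
          fresh m refl with Freed.recoloured F m
          ... | inj₁ ∈φZ = c∉ ∈φZ
          ... | inj₂ (u∈vs , eq) = c-free (subst (_∈ map φ vs) (sym eq) (∈-map⁺ φ u∈vs))
        ... | yes c-used with w , w∈vs , refl ← ∈-map⁻ φ c-used =
          augment k (w ∷ Z) (subst (length vs <_) (+-suc _ k) big)
            (All.tabulate (λ { z′∈Z refl → c∉ (∈-map⁺ φ z′∈Z) }) ∷ uZ)
            (λ { (here refl) → w∈vs ; (there z′∈Z) → Z⊆vs z′∈Z })
            (λ { (here refl) → weaken w (freed (here refl))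
               ; (there (here refl)) → freed-w
               ; (there (there z′∈Z)) → weaken w (freed (there z′∈Z)) })
          where
          F = freed z∈S
          keep : ∀ {u} → Others w u → u ≢ z → Others z u × Freed.ψ F u ≢ φ w
          keep (u∈ , u≢w) u≢z = (u∈ , u≢z) , λ eq → clash eq (Freed.recoloured F (u∈ , u≢z))
            where
            clash : Freed.ψ F _ ≡ φ w → _ → ⊥
            clash eq (inj₁ ∈φZ) = c∉ (subst (_∈ map φ Z) eq ∈φZ)
            clash eq (inj₂ (u∈vs , eq′)) = u≢w (injective rep u∈vs w∈vs (trans (sym eq′) eq))
          -- Here `z` takes the colour of `w`, and `w` becomes the vertex left without one.
          freed-w : Freed (w ∷ Z) w
          freed-w = record
            { ψ = Freed.ψ F [ z ↦ φ w ]
            ; represents = represents-update (Freed.represents F) c∈Lz keep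
            ; recoloured = rec
            }
            where
            rec : ∀ {u} → Others w u →
              (Freed.ψ F [ z ↦ φ w ]) u ∈ map φ (w ∷ Z) ⊎ (u ∈ vs × (Freed.ψ F [ z ↦ φ w ]) u ≡ φ u)
            rec {u} m with u ≟ z
            ... | yes _ = inj₁ (here refl)
            ... | no u≢z = Sum.map₁ there (Freed.recoloured F (proj₁ m , u≢z))

      -- Hall's theorem as a constructive alternative. Vertices are added one at a time: a violator
      -- for the tail remains one, and otherwise augmentation starts from an empty `Z`, with only
      -- `v` lacking a colour.
      hall : ∀ vs → Unique vs → (∃ λ φ → Represents L (_∈ vs) φ) ⊎ HallViolator L vs
      hall [] _ = inj₁ ((λ _ → 0) , record { chosen = λ () ; injective = λ () })
      hall (v ∷ vs) uniq@(_ ∷ u) with hall vs u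
      ... | inj₂ viol = inj₂ record
        { HallViolator viol ; included = there ∘ HallViolator.included viol }
      ... | inj₁ (φ , rep) = augment (suc (length vs)) [] ≤-refl [] (λ ()) start
        where
        open Augment uniq rep
        start : ∀ {z} → z ∈ v ∷ [] → Freed [] z
        start (here refl) = record
          { ψ = φ
          ; represents = record
            { chosen = λ m → chosen rep (old m)
            ; injective = λ m m′ → injective rep (old m) (old m′) }
          ; recoloured = λ m → inj₂ (old m , refl)
          }
          where
          old : ∀ {u} → Others v u → u ∈ vs
          old (here u≡v , u≢v) = contradiction u≡v u≢v
          old (there u∈vs , _) = u∈vs

    -- List colouring of complete multipartite graphs with parts of size at most two.

    -- A part is a pair of vertices; a one-vertex part {s} is encoded as (s , s).
    _∈ₚ_ : A → A × A → Set
    u ∈ₚ (x , y) = u ≡ x ⊎ u ≡ y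

    Apart : A × A → A × A → Set
    Apart p q = ∀ {u} → u ∈ₚ p → ¬ u ∈ₚ q

    both : List (A × A) → List A
    both [] = []
    both ((x , y) ∷ ps) = x ∷ y ∷ both ps

    length-both : ∀ ps → length (both ps) ≡ length ps + length ps
    length-both [] = refl
    length-both (_ ∷ ps) = cong suc (trans (cong suc (length-both ps)) (sym (+-suc _ _)))

    ∈-both⁺ : ∀ {ps p u} → p ∈ ps → u ∈ₚ p → u ∈ both ps
    ∈-both⁺ (here refl) (inj₁ refl) = here refl
    ∈-both⁺ (here refl) (inj₂ refl) = there (here refl)
    ∈-both⁺ (there p∈) u∈ = there (there (∈-both⁺ p∈ u∈))

    ∈-both⁻ : ∀ {u} ps → u ∈ both ps → ∃ λ p → p ∈ ps × u ∈ₚ p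
    ∈-both⁻ (p ∷ _) (here refl) = p , here refl , inj₁ refl
    ∈-both⁻ (p ∷ _) (there (here refl)) = p , here refl , inj₂ refl
    ∈-both⁻ (_ ∷ ps) (there (there u∈)) with q , q∈ , u∈q ← ∈-both⁻ ps u∈ = q , there q∈ , u∈q

    Unique-both : ∀ {ps} → AllPairs Apart ps → (∀ {x y} → (x , y) ∈ ps → x ≢ y) → Unique (both ps)
    Unique-both [] _ = []
    Unique-both {(x , y) ∷ ps} (apart ∷ aps) proper =
      (proper (here refl) ∷ All.tabulate (fresh (inj₁ refl))) ∷
      All.tabulate (fresh (inj₂ refl)) ∷ Unique-both aps (proper ∘ there)
      where
      fresh : ∀ {u} → u ∈ₚ (x , y) → ∀ {w} → w ∈ both ps → u ≢ w
      fresh u∈ w∈ refl with q , q∈ , w∈q ← ∈-both⁻ ps w∈ = All.lookup apart q∈ u∈ w∈q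

    samePart : ∀ {ps p q u} → AllPairs Apart ps → p ∈ ps → q ∈ ps → u ∈ₚ p → u ∈ₚ q → p ≡ q
    samePart aps p∈ q∈ u∈p u∈q with ∈-AllPairs₂ aps p∈ q∈
    ... | inj₁ p≡q = p≡q
    ... | inj₂ (inj₁ apart) = contradiction u∈q (apart u∈p)
    ... | inj₂ (inj₂ apart) = contradiction u∈p (apart u∈q)

    record PartColouring (L : A → List ℕ) (Part : A × A → Set) : Set where
      field
        colour    : A → ℕ
        chosen    : ∀ {p u} → Part p → u ∈ₚ p → colour u ∈ L u
        separates : ∀ {p q u w} → Part p → Part q → u ∈ₚ p → w ∈ₚ q → colour u ≡ colour w → p ≡ q

    Large : (A → List ℕ) → ℕ → List (A × A) → Set
    Large L r ps = ∀ {p u} → p ∈ ps → u ∈ₚ p → r ≤ length (L u)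

    Clashing : (A → List ℕ) → A × A → Set
    Clashing L (x , y) = ∀ {c} → c ∈ L x → c ∉ L y

    -- With r parts, a Hall violator containing a whole part covers at least 2 r colours but has
    -- at most 2 r vertices, and one meeting every part at most once has at most r vertices.
    colour-clashing : ∀ {L} → (∀ u → Unique (L u)) → ∀ D → AllPairs Apart D →
      Large L (length D) D → (∀ {p} → p ∈ D → Clashing L p) → PartColouring L (_∈ D)
    colour-clashing {L} uL D aps large clash with hall {L} (both D) (Unique-both aps proper)
      where
      proper : ∀ {x y} → (x , y) ∈ D → x ≢ y
      -- A part `(x , x)` whose lists share no colour has an empty list, but the presence of this
      -- part makes `length D` positive.
      proper {x} xy∈D refl with L x in eq | clash xy∈D
      ... | [] | _ = <⇒≱ (∈-length xy∈D) (≤-trans (large xy∈D (inj₁ refl)) (≤-reflexive (cong length eq)))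
      ... | c ∷ _ | cl = cl (here refl) (here refl)
    ... | inj₁ (φ , rep) = record
      { colour = φ
      ; chosen = λ p∈ u∈ → chosen rep (∈-both⁺ p∈ u∈)
      ; separates = λ p∈ q∈ u∈p w∈q eq → samePart aps p∈ q∈ u∈p
          (subst (_∈ₚ _) (sym (injective rep (∈-both⁺ p∈ u∈p) (∈-both⁺ q∈ w∈q) eq)) w∈q)
      }
    ... | inj₂ viol = ⊥-elim impossible
      where
      open HallViolator viol
      sel : A × A → A
      sel (x , y) with x ∈? members
      ... | yes _ = x
      ... | no  _ = y
      full? : ∀ p → Dec (proj₁ p ∈ members × proj₂ p ∈ members)
      full? (x , y) = (x ∈? members) ×-dec (y ∈? members)
      impossible : ⊥
      impossible with any? full? D
      ... | yes full with (x , y) , p∈ , x∈ , y∈ ← find full = <⇒≱ deficit (begin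
        length members ≤⟨ Unique⇒length≤ unique included ⟩
        length (both D) ≡⟨ length-both D ⟩
        length D + length D ≤⟨ +-mono-≤ (large p∈ (inj₁ refl)) (large p∈ (inj₂ refl)) ⟩
        length (L x) + length (L y) ≡⟨ length-++ (L x) ⟨
        length (L x ++ L y) ≤⟨ Unique⇒length≤ (Uniq.++⁺ (uL x) (uL y) (λ (c∈x , c∈y) → clash p∈ c∈x c∈y)) inC ⟩
        length colours ∎)
        where
        open ≤-Reasoning
        inC : L x ++ L y ⊆ colours
        inC c∈ with ∈-++⁻ (L x) c∈
        ... | inj₁ c∈x = covered x∈ c∈x
        ... | inj₂ c∈y = covered y∈ c∈y
      ... | no ¬full = nonempty members refl
        where
        -- One selected vertex per part catches every member, because no part lies entirely in
        -- `members`.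
        members⊆sel : members ⊆ map sel D
        members⊆sel {u} u∈ with (x , y) , p∈ , u∈p ← ∈-both⁻ D (included u∈) =
          subst (_∈ map sel D) (sel≡ u∈p) (∈-map⁺ sel p∈)
          where
          sel≡ : u ∈ₚ (x , y) → sel (x , y) ≡ u
          sel≡ u∈p with x ∈? members | u∈p
          ... | yes _  | inj₁ refl = refl
          ... | yes x∈ | inj₂ refl = contradiction (lose p∈ (x∈ , u∈)) ¬full
          ... | no x∉  | inj₁ refl = contradiction u∈ x∉
          ... | no _   | inj₂ refl = refl
        -- The strict `deficit` forces a member to exist, and the list of that member alone has at
        -- least `length D` colours.
        nonempty : ∀ S → S ≡ members → ⊥
        nonempty [] refl = n≮0 deficit
        nonempty (u ∷ _) refl with p , p∈ , u∈p ← ∈-both⁻ D (included (here refl)) = <⇒≱ deficit (begin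
          length members ≤⟨ Unique⇒length≤ unique members⊆sel ⟩
          length (map sel D) ≡⟨ length-map sel D ⟩
          length D ≤⟨ large p∈ u∈p ⟩
          length (L u) ≤⟨ Unique⇒length≤ (uL u) (covered (here refl)) ⟩
          length colours ∎)
          where open ≤-Reasoning

    -- A part whose two lists share a colour gets that colour; the others accumulate in D.
    colourPartsFrom : ∀ {L} → (∀ u → Unique (L u)) → ∀ D T → AllPairs Apart (T ++ D) →
      Large L (length (T ++ D)) (T ++ D) → (∀ {p} → p ∈ D → Clashing L p) →
      PartColouring L (_∈ T ++ D)
    colourPartsFrom uL D [] aps large clash = colour-clashing uL D aps large clash
    colourPartsFrom {L} uL D ((x , y) ∷ T) aps large clash with any? (_∈ᶜ? L y) (L x)
    ... | no none = record
      { colour = colour IH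
      ; chosen = PartColouring.chosen IH ∘ move
      ; separates = λ p∈ q∈ → separates IH (move p∈) (move q∈)
      }
      where
      open PartColouring using (colour; separates)
      perm : (x , y) ∷ T ++ D ↭ T ++ (x , y) ∷ D
      perm = ↭-sym (shift (x , y) T D)
      move : ∀ {p} → p ∈ (x , y) ∷ T ++ D → p ∈ T ++ (x , y) ∷ D
      move = ∈-resp-↭ perm
      IH : PartColouring L (_∈ T ++ (x , y) ∷ D)
      IH = colourPartsFrom uL ((x , y) ∷ D) T
        (AllPairs-resp-↭ {R = Apart} (λ apart u∈q u∈p → apart u∈p u∈q) perm aps)
        (λ p∈ u∈ → ≤-trans (≤-reflexive (↭-length (↭-sym perm))) (large (∈-resp-↭ (↭-sym perm) p∈) u∈))
        (λ { (here refl) c∈x c∈y → none (lose c∈x c∈y) ; (there p∈) → clash p∈ })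
    ... | yes common with c , c∈x , c∈y ← find common | apart ∷ aps′ ← aps = record
      { colour = φ
      ; chosen = λ { (here refl) (inj₁ refl) → subst (_∈ L x) (sym (φ-new (inj₁ refl))) c∈x
                   ; (here refl) (inj₂ refl) → subst (_∈ L y) (sym (φ-new (inj₂ refl))) c∈y
                   ; (there p∈) u∈p → subst (_∈ L _) (sym (φ-old p∈ u∈p))
                       (proj₁ (∈-filter⁻ keep? {xs = L _} (PartColouring.chosen IH p∈ u∈p))) }
      ; separates = sep
      }
      where
      open PartColouring using (colour; separates)
      keep? : Decidable (λ d → d ∉ c ∷ [])
      keep? d = ¬? (d ∈ᶜ? (c ∷ []))
      -- Removing `c` costs each list at most one colour while the number of parts drops by one, so
      -- the size hypothesis survives.
      L′ : A → List ℕ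
      L′ u = filter keep? (L u)
      IH : PartColouring L′ (_∈ T ++ D)
      IH = colourPartsFrom (λ u → Uniq.filter⁺ keep? (uL u)) D T aps′
        (λ {_} {u} p∈ u∈p → +-cancelʳ-≤ 1 _ _ (≤-trans (≤-reflexive (+-comm _ 1))
          (≤-trans (large (there p∈) u∈p) (length-without ℕ._≟_ (c ∷ []) (uL u)))))
        (λ p∈ c∈x c∈y → clash p∈ (proj₁ (∈-filter⁻ keep? {xs = L _} c∈x)) (proj₁ (∈-filter⁻ keep? {xs = L _} c∈y)))
      φ : A → ℕ
      φ = (colour IH [ x ↦ c ]) [ y ↦ c ]
      φ-new : ∀ {u} → u ∈ₚ (x , y) → φ u ≡ c
      φ-new {u} u∈ with u ≟ y
      ... | yes _ = refl
      ... | no u≢y with u∈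
      ...   | inj₁ u≡x = update-≡ (colour IH) u≡x
      ...   | inj₂ u≡y = contradiction u≡y u≢y
      φ-old : ∀ {p u} → p ∈ T ++ D → u ∈ₚ p → φ u ≡ colour IH u
      φ-old p∈ u∈p = trans
        (update-≢ (colour IH [ x ↦ c ]) (λ u≡y → All.lookup apart p∈ (inj₂ u≡y) u∈p))
        (update-≢ (colour IH) (λ u≡x → All.lookup apart p∈ (inj₁ u≡x) u∈p))
      fresh : ∀ {p u} → p ∈ T ++ D → u ∈ₚ p → φ u ≢ c
      fresh p∈ u∈p eq = proj₂ (∈-filter⁻ keep? {xs = L _} (PartColouring.chosen IH p∈ u∈p))
        (here (trans (sym (φ-old p∈ u∈p)) eq))
      sep : ∀ {p q u w} → p ∈ (x , y) ∷ T ++ D → q ∈ (x , y) ∷ T ++ D →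
        u ∈ₚ p → w ∈ₚ q → φ u ≡ φ w → p ≡ q
      sep (here refl) (here refl) _ _ _ = refl
      sep (here refl) (there q∈) u∈ w∈ eq = contradiction (trans (sym eq) (φ-new u∈)) (fresh q∈ w∈)
      sep (there p∈) (here refl) u∈ w∈ eq = contradiction (trans eq (φ-new w∈)) (fresh p∈ u∈)
      sep (there p∈) (there q∈) u∈ w∈ eq =
        separates IH p∈ q∈ u∈ w∈ (trans (sym (φ-old p∈ u∈)) (trans eq (φ-old q∈ w∈)))

    -- The Erdős-Rubin-Taylor theorem: with r parts of size at most two, lists of size r suffice.
    -- The accumulator of clashing parts starts empty.
    colourParts : ∀ {L} → (∀ u → Unique (L u)) → ∀ ps → AllPairs Apart ps →
      Large L (length ps) ps → PartColouring L (_∈ ps)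
    colourParts {L} uL ps = subst
      (λ qs → AllPairs Apart qs → Large L (length qs) qs → PartColouring L (_∈ qs)) (++-identityʳ ps)
      (λ aps large → colourPartsFrom uL [] ps aps large (λ ()))

  -- Counting edges and non-edges within a list of vertices.

  module _ {A : Set} {R : A → A → Set} (R? : Decidable₂ R) where

    -- Each pair is counted once, at its earlier entry, so on a duplicate-free list a reflexive `R`
    -- contributes no loops.
    pairs : List A → ℕ
    pairs [] = 0
    pairs (u ∷ H) = length (filter (R? u) H) + pairs H

    pairs-swap : Symmetric R → ∀ u w H → pairs (u ∷ w ∷ H) ≡ pairs (w ∷ u ∷ H)
    pairs-swap symR u w H with R? u w | R? w u
    ... | yes _ | yes _ = cong suc (x∙yz≈y∙xz (length (filter (R? u) H)) (length (filter (R? w) H)) (pairs H))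
    ... | yes r | no ¬r = contradiction (symR r) ¬r
    ... | no ¬r | yes r = contradiction (symR r) ¬r
    ... | no _  | no _ = x∙yz≈y∙xz (length (filter (R? u) H)) (length (filter (R? w) H)) (pairs H)

    pairs-↭ : Symmetric R → ∀ {H K} → H ↭ K → pairs H ≡ pairs K
    pairs-↭ symR ↭refl = refl
    pairs-↭ symR (prep u p) = cong₂ _+_ (↭-length (filter-↭ (R? u) p)) (pairs-↭ symR p)
    pairs-↭ symR (swap u w p) = trans
      (cong₂ _+_ (↭-length (filter-↭ (R? u) (prep w p)))
        (cong₂ _+_ (↭-length (filter-↭ (R? w) p)) (pairs-↭ symR p)))
      (pairs-swap symR u w _)
    pairs-↭ symR (↭trans p q) = trans (pairs-↭ symR p) (pairs-↭ symR q)

  -- Related and unrelated pairs together number `length H` choose 2; the form chosen avoids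
  -- division and subtraction and matches that of `nC2`.
  pairs-complement : ∀ {A : Set} {R : A → A → Set} (R? : Decidable₂ R) H →
    2 * (pairs R? H + pairs (λ u w → ¬? (R? u w)) H) + length H ≡ length H * length H
  pairs-complement R? [] = refl
  pairs-complement R? (u ∷ H) =
    trans (regroup a (pairs R? H) b (pairs (λ u w → ¬? (R? u w)) H) (length H))
      (trans
        (cong₂ (λ x y → 2 * x + y + 1) (length-filter-complement (R? u) H) (pairs-complement R? H))
        (square (length H)))
    where
    a = length (filter (R? u) H)
    b = length (filter (¬? ∘ R? u) H)
    regroup : ∀ a p b q l → 2 * (a + p + (b + q)) + suc l ≡ 2 * (a + b) + (2 * (p + q) + l) + 1
    regroup = solve-∀
    square : ∀ l → 2 * l + l * l + 1 ≡ suc l * suc l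
    square = solve-∀

  -- Maximal matchings of the complement and the partitions they induce.

  module _ {n} (G : Graph n) where

    open Colouring (Fin._≟_ {n})

    Adj : Fin n → Fin n → Set
    Adj u w = adj G u w ≡ true

    adj? : Decidable₂ Adj
    adj? u w = adj G u w Bool.≟ true

    nonadj? : Decidable₂ (λ u w → ¬ Adj u w)
    nonadj? u w = ¬? (adj? u w)

    Adj-sym : Symmetric Adj
    Adj-sym {u} {w} = trans (Graph.sym G w u)

    nonadj-refl : ∀ {u} → ¬ Adj u u
    nonadj-refl {u} uu with () ← trans (sym uu) (irrefl G u)

    Clique : List (Fin n) → Set
    Clique S = ∀ {a b} → a ∈ S → b ∈ S → a ≢ b → Adj a b

    -- Maximality is expressed by `clique`: two non-adjacent unmatched vertices could still be
    -- paired.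
    record Antimatching (H : List (Fin n)) : Set where
      field
        matched   : List (Fin n × Fin n)
        unmatched : List (Fin n)
        perm      : H ↭ both matched ++ unmatched
        nonadj    : ∀ {x y} → (x , y) ∈ matched → ¬ Adj x y
        clique    : Clique unmatched

    -- A maximal (not necessarily maximum) matching of the complement, built greedily.
    antimatching : ∀ H → Antimatching H
    antimatching [] = record { matched = [] ; unmatched = [] ; perm = ↭-refl ; nonadj = λ () ; clique = λ () }
    antimatching (u ∷ H) with antimatching H
    ... | record { matched = M ; unmatched = S ; perm = π ; nonadj = na ; clique = cl }
      with any? (nonadj? u) S
    ...   | no none = record
      { matched = M
      ; unmatched = u ∷ S
      ; perm = ↭-trans (prep u π) (↭-sym (shift u (both M) S))
      ; nonadj = na
      ; clique = λ { (here refl) (here refl) u≢u → contradiction refl u≢u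
                   ; (here refl) (there b∈) _ → toAll b∈
                   ; (there a∈) (here refl) _ → Adj-sym (toAll a∈)
                   ; (there a∈) (there b∈) → cl a∈ b∈ }
      }
      where
      toAll : ∀ {s} → s ∈ S → Adj u s
      toAll {s} s∈ = decidable-stable (adj? u s) (λ ¬us → none (lose s∈ ¬us))
    ...   | yes found with s , s∈ , ¬us ← find found with S′ , σ ← ∈⇒↭∷ s∈ = record
      { matched = (u , s) ∷ M
      ; unmatched = S′
      ; perm = prep u (↭-trans π (↭-trans (++⁺ˡ (both M) σ) (shift s (both M) S′)))
      ; nonadj = λ { (here refl) → ¬us ; (there p∈) → na p∈ }
      ; clique = λ a∈ b∈ → cl (∈-resp-↭ (↭-sym σ) (there a∈)) (∈-resp-↭ (↭-sym σ) (there b∈))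
      }

    module _ {H} (uH : Unique H) (𝓜 : Antimatching H) where
      open Antimatching 𝓜

      single : Fin n → Fin n × Fin n
      single u = u , u

      parts : List (Fin n × Fin n)
      parts = matched ++ map single unmatched

      private
        ∈-parts⁻′ : ∀ M S {p u} → p ∈ M ++ map single S → u ∈ₚ p → u ∈ both M ++ S
        ∈-parts⁻′ M S p∈ u∈p with ∈-++⁻ M p∈
        ... | inj₁ p∈M = ∈-++⁺ˡ (∈-both⁺ p∈M u∈p)
        ... | inj₂ p∈S with s , s∈ , refl ← ∈-map⁻ single p∈S with u∈p
        ...   | inj₁ refl = ∈-++⁺ʳ (both M) s∈
        ...   | inj₂ refl = ∈-++⁺ʳ (both M) s∈

      ∈-parts⁻ : ∀ {p u} → p ∈ parts → u ∈ₚ p → u ∈ H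
      ∈-parts⁻ p∈ u∈p = ∈-resp-↭ (↭-sym perm) (∈-parts⁻′ matched unmatched p∈ u∈p)

      Unique-unmatched : Unique unmatched
      Unique-unmatched = go (both matched) (AllPairs-resp-↭ ≢-sym perm uH)
        where
        go : ∀ xs → Unique (xs ++ unmatched) → Unique unmatched
        go [] u = u
        go (_ ∷ xs) (_ ∷ u) = go xs u

      ∈-parts⁺ : ∀ {u} → u ∈ H → ∃ λ p → p ∈ parts × u ∈ₚ p
      ∈-parts⁺ u∈H with ∈-++⁻ (both matched) (∈-resp-↭ perm u∈H)
      ... | inj₁ u∈M with p , p∈ , u∈p ← ∈-both⁻ matched u∈M = p , ∈-++⁺ˡ p∈ , u∈p
      ... | inj₂ u∈S = single _ , ∈-++⁺ʳ matched (∈-map⁺ single u∈S) , inj₁ refl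

      parts-apart : AllPairs Apart parts
      parts-apart = go matched unmatched (AllPairs-resp-↭ ≢-sym perm uH)
        where
        go : ∀ M S → Unique (both M ++ S) → AllPairs Apart (M ++ map single S)
        go [] [] _ = []
        go [] (s ∷ S) (s∉ ∷ uS) = All.tabulate (λ q∈ → λ
          { (inj₁ refl) u∈q → All.lookup s∉ (∈-parts⁻′ [] S q∈ u∈q) refl
          ; (inj₂ refl) u∈q → All.lookup s∉ (∈-parts⁻′ [] S q∈ u∈q) refl }) ∷ go [] S uS
        go ((x , y) ∷ M) S ((_ ∷ x∉) ∷ y∉ ∷ uM) = All.tabulate (λ q∈ → λ
          { (inj₁ refl) u∈q → All.lookup x∉ (∈-parts⁻′ M S q∈ u∈q) refl
          ; (inj₂ refl) u∈q → All.lookup y∉ (∈-parts⁻′ M S q∈ u∈q) refl }) ∷ go M S uM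

      parts-nonadj : ∀ {p u w} → p ∈ parts → u ∈ₚ p → w ∈ₚ p → ¬ Adj u w
      parts-nonadj p∈ u∈p w∈p with ∈-++⁻ matched p∈
      parts-nonadj p∈ (inj₁ refl) (inj₁ refl) | inj₁ _ = nonadj-refl
      parts-nonadj p∈ (inj₁ refl) (inj₂ refl) | inj₁ p∈M = nonadj p∈M
      parts-nonadj p∈ (inj₂ refl) (inj₁ refl) | inj₁ p∈M = nonadj p∈M ∘ Adj-sym
      parts-nonadj p∈ (inj₂ refl) (inj₂ refl) | inj₁ _ = nonadj-refl
      ... | inj₂ p∈S with s , _ , refl ← ∈-map⁻ single p∈S with u∈p | w∈p
      ...   | inj₁ refl | inj₁ refl = nonadj-refl
      ...   | inj₁ refl | inj₂ refl = nonadj-refl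
      ...   | inj₂ refl | inj₁ refl = nonadj-refl
      ...   | inj₂ refl | inj₂ refl = nonadj-refl

      -- Each matched pair accounts for two vertices of `H` and each unmatched vertex for one, so
      -- doubling the number of parts counts the unmatched vertices once too often.
      length-parts : 2 * length parts ≡ length H + length unmatched
      length-parts
        rewrite ↭-length perm | length-++ matched {map single unmatched} | length-map single unmatched
              | length-++ (both matched) {unmatched} | length-both matched
        = arith (length matched) (length unmatched)
        where
        arith : ∀ m s → 2 * (m + s) ≡ m + m + s + s
        arith = solve-∀

  -- Degrees, criticality and the lower bound on non-edges.

  length-filter-tabulate : ∀ {A : Set} {m} (h : A → Bool) (g : Fin m → A) →
    length (filter (λ a → h a Bool.≟ true) (tabulate g)) ≡ count (h ∘ g)
  length-filter-tabulate {m = zero} h g = refl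
  length-filter-tabulate {m = suc m} h g with h (g fzero)
  ... | true  = cong suc (length-filter-tabulate h (g ∘ fsuc))
  ... | false = length-filter-tabulate h (g ∘ fsuc)

  ≤maxOver : ∀ {m} (f : Fin m → ℕ) i → f i ≤ maxOver f
  ≤maxOver f fzero = m≤m⊔n _ _
  ≤maxOver f (fsuc i) = ≤-trans (≤maxOver (f ∘ fsuc) i) (m≤n⊔m (f fzero) _)

  module _ {n} (G : Graph n) where

    open Colouring (Fin._≟_ {n})
    open import Data.List.Membership.DecPropositional (Fin._≟_ {n}) using (_∈?_)
    open import Data.List.Membership.DecPropositional ℕ._≟_ using () renaming (_∈?_ to _∈ᶜ?_)

    neighbours : Fin n → List (Fin n)
    neighbours u = filter (adj? G u) (allFin n)

    ∈-neighbours : ∀ {u w} → Adj G u w → w ∈ neighbours u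
    ∈-neighbours {u} {w} = ∈-filter⁺ (adj? G u) (∈-allFin w)

    Unique-neighbours : ∀ u → Unique (neighbours u)
    Unique-neighbours u = Uniq.filter⁺ (adj? G u) (Uniq.allFin⁺ n)

    length-neighbours≤maxDegree : ∀ u → length (neighbours u) ≤ maxDegree G
    length-neighbours≤maxDegree u =
      ≤-trans (≤-reflexive (length-filter-tabulate (adj G u) id)) (≤maxOver (degree G) u)

    -- Includes u itself when u ∈ H.
    missing : Fin n → List (Fin n) → ℕ
    missing u H = length (filter (nonadj? G u) H)

    outside : Fin n → List (Fin n) → List (Fin n)
    outside u H = filter (λ w → ¬? (w ∈? H)) (neighbours u)

    length-outside : ∀ u {H} → Unique H → length (outside u H) + length (filter (adj? G u) H) ≤ maxDegree G
    length-outside u {H} uH = begin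
      length (outside u H) + length (filter (adj? G u) H) ≡⟨ length-++ (outside u H) ⟨
      length (outside u H ++ filter (adj? G u) H)
        ≤⟨ Unique⇒length≤
             (Uniq.++⁺ (Uniq.filter⁺ _ (Unique-neighbours u)) (Uniq.filter⁺ _ uH) disjoint) sub ⟩
      length (neighbours u) ≤⟨ length-neighbours≤maxDegree u ⟩
      maxDegree G ∎
      where
      open ≤-Reasoning
      disjoint : ∀ {w} → ¬ (w ∈ outside u H × w ∈ filter (adj? G u) H)
      disjoint (o , i) = proj₂ (∈-filter⁻ (λ w → ¬? (w ∈? H)) {xs = neighbours u} o)
        (proj₁ (∈-filter⁻ (adj? G u) {xs = H} i))
      sub : outside u H ++ filter (adj? G u) H ⊆ neighbours u
      sub w∈ with ∈-++⁻ (outside u H) w∈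
      ... | inj₁ o = proj₁ (∈-filter⁻ (λ w → ¬? (w ∈? H)) {xs = neighbours u} o)
      ... | inj₂ i = ∈-neighbours (proj₂ (∈-filter⁻ (adj? G u) {xs = H} i))

    deleteVertices : List (Fin n) → Subgraph G
    deleteVertices H = record
      { keepV = kept
      ; keepE = λ u w → adj G u w ∧ kept u ∧ kept w
      ; keepE-sym = λ u w → cong₂ _∧_ (Graph.sym G u w) (∧-comm (kept u) (kept w))
      ; keepE-ok = ok
      }
      where
      kept : Fin n → Bool
      kept u = not (does (u ∈? H))
      ok : ∀ u w → adj G u w ∧ kept u ∧ kept w ≡ true → adj G u w ≡ true × kept u ≡ true × kept w ≡ true
      ok u w eq with adj G u w | kept u | kept w | eq
      ... | true | true | true | refl = refl , refl , refl

    kept-∉ : ∀ H {u} → u ∉ H → keepV (deleteVertices H) u ≡ true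
    kept-∉ H {u} u∉ = cong not (dec-false (u ∈? H) u∉)

    module _ {L : ListAssignment n} (crit : IsCritical G L) {k s ω : ℕ}
      (kL : IsKListAssignment L k) (s+k : s + k ≡ suc (maxDegree G))
      (cliques : ∀ {S : List (Fin n)} → Unique S → Clique G S → length S ≤ ω) where

      module Extend {H : List (Fin n)} (uH : Unique H) {v : Fin n} (v∈H : v ∈ H) where

        exterior : ∃ λ (φ : Fin n → ℕ) → (∀ u → keepV (deleteVertices H) u ≡ true → φ u ∈ L u) ×
                        (∀ u w → keepE (deleteVertices H) u w ≡ true → φ u ≢ φ w)
        -- The vertex `v` of `H` is what makes the remaining subgraph proper.
        exterior = proj₂ crit (deleteVertices H) (inj₁ (v , cong not (dec-true (v ∈? H) v∈H)))

        φ : Fin n → ℕ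
        φ = proj₁ exterior

        free? : ∀ u → Decidable (λ c → c ∉ map φ (outside u H))
        free? u c = ¬? (c ∈ᶜ? map φ (outside u H))

        L′ : Fin n → List ℕ
        L′ u = filter (free? u) (L u)

        -- Deleting the colours seen outside `H` leaves at least `k - o` of them, where `d + o ≤ Δ`,
        -- `k = Δ + 1 - s` and `d = length H - missing u H`. For `u` in `H` the summand 1
        -- compensates for `missing` counting `u` itself.
        length-L′ : ∀ u → length H + 1 ≤ length (L′ u) + s + missing u H
        length-L′ u = +-cancelʳ-≤ (d + o + k) _ _ (begin
          length H + 1 + (d + o + k)
            ≤⟨ +-monoʳ-≤ (length H + 1) (+-mono-≤ d+o≤Δ k≤) ⟩
          length H + 1 + (Δ + (length (L′ u) + o))
            ≡⟨ cong (λ l → l + 1 + (Δ + (length (L′ u) + o))) (length-filter-complement (adj? G u) H) ⟨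
          d + missing u H + 1 + (Δ + (length (L′ u) + o))
            ≡⟨ regroup d (missing u H) Δ (length (L′ u)) o ⟩
          length (L′ u) + missing u H + (d + o) + suc Δ
            ≡⟨ cong (length (L′ u) + missing u H + (d + o) +_) s+k ⟨
          length (L′ u) + missing u H + (d + o) + (s + k)
            ≡⟨ regroup′ (length (L′ u)) (missing u H) (d + o) s k ⟩
          length (L′ u) + s + missing u H + (d + o + k) ∎)
          where
          open ≤-Reasoning
          d = length (filter (adj? G u) H)
          o = length (outside u H)
          Δ = maxDegree G
          d+o≤Δ : d + o ≤ Δ
          d+o≤Δ = ≤-trans (≤-reflexive (+-comm d o)) (length-outside u uH)
          k≤ : k ≤ length (L′ u) + o
          k≤ = ≤-trans (proj₂ kL u) (≤-trans
            (length-without ℕ._≟_ (map φ (outside u H)) (proj₁ (proj₁ kL u)))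
            (≤-reflexive (cong (length (L′ u) +_) (length-map φ (outside u H)))))
          regroup : ∀ d m Δ l o → d + m + 1 + (Δ + (l + o)) ≡ l + m + (d + o) + suc Δ
          regroup = solve-∀
          regroup′ : ∀ l m x s k → l + m + x + (s + k) ≡ l + s + m + (x + k)
          regroup′ = solve-∀

        -- The lists `L′` avoid the colours that `φ` uses next to `H`, so such a `χ` would glue with
        -- `φ` to an `L`-colouring of the whole graph.
        uncolourable : ¬ (∃ λ (χ : Fin n → ℕ) → (∀ {u} → u ∈ H → χ u ∈ L′ u) ×
                                  (∀ {u w} → u ∈ H → w ∈ H → Adj G u w → χ u ≢ χ w))
        uncolourable (χ , χ∈ , χ-proper) = proj₁ crit (ψ , ψ∈ , ψ-proper)
          where
          ψ : Fin n → ℕ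
          ψ u with u ∈? H
          ... | yes _ = χ u
          ... | no  _ = φ u
          ψ∈ : ∀ u → ψ u ∈ L u
          ψ∈ u with u ∈? H
          ... | yes u∈ = proj₁ (∈-filter⁻ (free? u) {xs = L u} (χ∈ u∈))
          ... | no u∉ = proj₁ (proj₂ exterior) u (kept-∉ H u∉)
          crossing : ∀ {u w} → u ∈ H → w ∉ H → Adj G u w → χ u ≢ φ w
          crossing {u} {w} u∈ w∉ uw eq = proj₂ (∈-filter⁻ (free? u) {xs = L u} (χ∈ u∈))
            (subst (_∈ map φ (outside u H)) (sym eq)
              (∈-map⁺ φ (∈-filter⁺ (λ w → ¬? (w ∈? H)) (∈-neighbours uw) w∉)))
          ψ-proper : ∀ u w → adj G u w ≡ true → ψ u ≢ ψ w
          ψ-proper u w uw with u ∈? H | w ∈? H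
          ... | yes u∈ | yes w∈ = χ-proper u∈ w∈ uw
          ... | yes u∈ | no w∉ = crossing u∈ w∉ uw
          ... | no u∉ | yes w∈ = ≢-sym (crossing w∈ u∉ (Adj-sym G uw))
          ... | no u∉ | no w∉ = proj₂ (proj₂ exterior) u w
            (trans (cong₂ _∧_ uw (cong₂ _∧_ (kept-∉ H u∉) (kept-∉ H w∉))) refl)

      -- If every vertex of `H` fell short of this bound, each list `L′ u` would have as many
      -- colours as there are parts. `colourParts` would then colour `H`, with vertices of equal
      -- colour in a common part and hence non-adjacent.
      many-missing : ∀ {H} → Unique H → ∀ {v} → v ∈ H →
        ∃ λ u → u ∈ H × 4 + length H ≤ ω + 2 * s + 2 * missing u H
      many-missing {H} uH v∈H with any? (λ u → 4 + length H ≤? ω + 2 * s + 2 * missing u H) H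
      ... | yes found = find found
      ... | no none = ⊥-elim (uncolourable (colour ,
          (λ u∈ → let p , p∈ , u∈p = ∈-parts⁺ G uH 𝓜 u∈ in chosen p∈ u∈p) ,
          (λ u∈ w∈ uw eq →
            let p , p∈ , u∈p = ∈-parts⁺ G uH 𝓜 u∈
                q , q∈ , w∈q = ∈-parts⁺ G uH 𝓜 w∈
            in parts-nonadj G uH 𝓜 p∈ u∈p (subst (_ ∈ₚ_) (sym (separates p∈ q∈ u∈p w∈q eq)) w∈q) uw)))
        where
        open Extend uH v∈H
        𝓜 = antimatching G H
        ps = parts G uH 𝓜
        few : length (Antimatching.unmatched 𝓜) ≤ ω
        few = cliques (Unique-unmatched G uH 𝓜) (Antimatching.clique 𝓜)
        large : ∀ {u} → u ∈ H → length ps ≤ length (L′ u)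
        -- The constant 4 has two sources: the doubled 1 of `length-L′`, and 2 from asking only for
        -- `length ps < suc (length (L′ u))`.
        large {u} u∈ = ≤-pred (*-cancelˡ-< 2 _ _ (+-cancelʳ-< (2 * (s + missing u H)) _ _ (begin-strict
          2 * length ps + 2 * (s + missing u H) ≡⟨ cong (_+ 2 * (s + missing u H)) (length-parts G uH 𝓜) ⟩
          length H + length (Antimatching.unmatched 𝓜) + 2 * (s + missing u H)
            ≤⟨ +-monoˡ-≤ _ (+-monoʳ-≤ (length H) few) ⟩
          length H + ω + 2 * (s + missing u H) ≡⟨ regroup (length H) ω s (missing u H) ⟩
          length H + (ω + 2 * s + 2 * missing u H) <⟨ +-monoʳ-< (length H) (≰⇒> (λ le → none (lose u∈ le))) ⟩
          length H + (4 + length H) ≡⟨ regroup₂ (length H) ⟩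
          2 * (length H + 1) + 2 ≤⟨ +-monoˡ-≤ 2 (*-monoʳ-≤ 2 (length-L′ u)) ⟩
          2 * (length (L′ u) + s + missing u H) + 2 ≡⟨ regroup₃ (length (L′ u)) s (missing u H) ⟩
          2 * suc (length (L′ u)) + 2 * (s + missing u H) ∎)))
          where
          open ≤-Reasoning
          regroup : ∀ h ω s m → h + ω + 2 * (s + m) ≡ h + (ω + 2 * s + 2 * m)
          regroup = solve-∀
          regroup₂ : ∀ h → h + (4 + h) ≡ 2 * (h + 1) + 2
          regroup₂ = solve-∀
          regroup₃ : ∀ l s m → 2 * (l + s + m) + 2 ≡ 2 * suc l + 2 * (s + m)
          regroup₃ = solve-∀
        coloured : PartColouring L′ (_∈ ps)
        coloured = colourParts (λ u → Uniq.filter⁺ (free? u) (proj₁ (proj₁ kL u))) ps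
          (parts-apart G uH 𝓜) (λ p∈ u∈p → large (∈-parts⁻ G uH 𝓜 p∈ u∈p))
        open PartColouring coloured

      -- Deleting the vertex found by many-missing lowers t by one and the number of
      -- non-edges by at least t / 2 + 1; summing over the deletions gives t ² / 4.
      square≤nonedges : ∀ t {H} → Unique H → ω + 2 * s + t ≤ length H → t * t ≤ 4 * pairs (nonadj? G) H
      square≤nonedges zero _ _ = z≤n
      square≤nonedges (suc t) {[]} uH le =
        contradiction (≤-trans (m≤n+m (suc t) (ω + 2 * s)) le) (λ ())
      square≤nonedges (suc t) {H@(_ ∷ _)} uH le with many-missing uH (here refl)
      ... | u , u∈H , poor with H′ , π ← ∈⇒↭∷ u∈H with _ ∷ uH′ ← AllPairs-resp-↭ ≢-sym π uH = begin
        suc t * suc t ≤⟨ m≤m+n _ 3 ⟩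
        suc t * suc t + 3 ≡⟨ regroup t ⟩
        t * t + 2 * (suc t + 1) ≤⟨ +-mono-≤ IH (*-monoʳ-≤ 2 drop) ⟩
        4 * pairs (nonadj? G) H′ + 2 * (2 * missing u H′) ≡⟨ regroup₂ (pairs (nonadj? G) H′) (missing u H′) ⟩
        4 * pairs (nonadj? G) (u ∷ H′) ≡⟨ cong (4 *_) (pairs-↭ (nonadj? G) (λ ¬uw wu → ¬uw (Adj-sym G wu)) π) ⟨
        4 * pairs (nonadj? G) H ∎
        where
        open ≤-Reasoning
        lengthH : length H ≡ suc (length H′)
        lengthH = ↭-length π
        IH : t * t ≤ 4 * pairs (nonadj? G) H′
        IH = square≤nonedges t uH′ (≤-pred (begin
          suc (ω + 2 * s + t) ≡⟨ +-suc (ω + 2 * s) t ⟨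
          ω + 2 * s + suc t ≤⟨ le ⟩
          length H ≡⟨ lengthH ⟩
          suc (length H′) ∎))
        -- The deleted vertex counts itself in `missing u H`; only its other non-neighbours form
        -- pairs with it.
        missing-u : missing u H ≡ suc (missing u H′)
        missing-u = trans (↭-length (filter-↭ (nonadj? G u) π))
          (cong length (filter-accept (nonadj? G u) {xs = H′} (nonadj-refl G)))
        drop : suc t + 1 ≤ 2 * missing u H′
        drop = +-cancelʳ-≤ (ω + 2 * s + 2) _ _ (begin
          suc t + 1 + (ω + 2 * s + 2) ≡⟨ regroup₃ (suc t) (ω + 2 * s) ⟩
          ω + 2 * s + suc t + 3 ≤⟨ +-monoˡ-≤ 3 le ⟩
          length H + 3 ≤⟨ +-monoʳ-≤ (length H) (n≤1+n 3) ⟩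
          length H + 4 ≡⟨ +-comm (length H) 4 ⟩
          4 + length H ≤⟨ poor ⟩
          ω + 2 * s + 2 * missing u H ≡⟨ cong (λ m → ω + 2 * s + 2 * m) missing-u ⟩
          ω + 2 * s + 2 * suc (missing u H′) ≡⟨ regroup₄ (ω + 2 * s) (missing u H′) ⟩
          2 * missing u H′ + (ω + 2 * s + 2) ∎)
          where
          regroup₃ : ∀ t a → t + 1 + (a + 2) ≡ a + t + 3
          regroup₃ = solve-∀
          regroup₄ : ∀ a m → a + 2 * suc m ≡ 2 * m + (a + 2)
          regroup₄ = solve-∀
        regroup : ∀ t → suc t * suc t + 3 ≡ t * t + 2 * (suc t + 1)
        regroup = solve-∀
        regroup₂ : ∀ p m → 4 * p + 2 * (2 * m) ≡ 4 * (m + p)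
        regroup₂ = solve-∀

  -- Neighbourhood edge counts as counts of pairs in a list.

  sumFin : ∀ {m} → (Fin m → ℕ) → ℕ
  sumFin {zero}  f = 0
  sumFin {suc m} f = f fzero + sumFin (f ∘ fsuc)

  count-false : ∀ m → count {m} (λ _ → false) ≡ 0
  count-false zero = refl
  count-false (suc m) = count-false m

  count-cong : ∀ {m} {f g : Fin m → Bool} → (∀ i → f i ≡ g i) → count f ≡ count g
  count-cong {zero} eq = refl
  count-cong {suc m} eq = cong₂ _+_ (cong (if_then 1 else 0) (eq fzero)) (count-cong (eq ∘ fsuc))

  count≤ : ∀ {m} (f : Fin m → Bool) → count f ≤ m
  count≤ {zero} f = z≤n
  count≤ {suc m} f with f fzero
  ... | true  = s≤s (count≤ (f ∘ fsuc))
  ... | false = ≤-trans (count≤ (f ∘ fsuc)) (n≤1+n m)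

  module _ {A : Set} {R : A → A → Bool} {f : A → Bool} where

    private
      R? : Decidable₂ (λ a b → R a b ≡ true)
      R? a b = R a b Bool.≟ true
      f? : Decidable (λ a → f a ≡ true)
      f? a = f a Bool.≟ true

    length-filter-filter-tabulate : ∀ a {m} (g : Fin m → A) →
      length (filter (R? a) (filter f? (tabulate g))) ≡ count (λ w → f (g w) ∧ R a (g w))
    length-filter-filter-tabulate a {zero} g = refl
    length-filter-filter-tabulate a {suc m} g with f (g fzero)
    ... | false = length-filter-filter-tabulate a (g ∘ fsuc)
    ... | true with R a (g fzero)
    ...   | false = length-filter-filter-tabulate a (g ∘ fsuc)
    ...   | true  = cong suc (length-filter-filter-tabulate a (g ∘ fsuc))

    -- The index test corresponds to the order of positions in the tabulated list: when index zero
    -- is peeled off, it computes to true against every later index and to false in the opposite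
    -- direction.
    pairs-filter-tabulate : ∀ {m} (g : Fin m → A) → pairs R? (filter f? (tabulate g)) ≡
      sumFin (λ u → count (λ w → (toℕ u <ᵇ toℕ w) ∧ f (g u) ∧ f (g w) ∧ R (g u) (g w)))
    pairs-filter-tabulate {zero} g = refl
    pairs-filter-tabulate {suc m} g with f (g fzero)
    ... | true  = cong₂ _+_ (length-filter-filter-tabulate (g fzero) (g ∘ fsuc)) (pairs-filter-tabulate (g ∘ fsuc))
    ... | false = cong₂ _+_ (sym (count-false m)) (pairs-filter-tabulate (g ∘ fsuc))

  -- The summation inside nbhdEdges is local to its definition and cannot be named, so the
  -- left-hand side of the first equation is left to be inferred from the second one; the
  -- with-abstractions turn that inference into a pattern-unification problem.
  mutual
    hiddenSum≡sumFin : ∀ {N} (G : Graph N) (v : Fin N) {m} (f : Fin m → ℕ) → _ ≡ sumFin f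
    hiddenSum≡sumFin G v {zero} f = refl
    hiddenSum≡sumFin G v {suc m} f = cong (f fzero +_) (hiddenSum≡sumFin G v (f ∘ fsuc))

    nbhdEdges≡sumFin : ∀ {n} (G : Graph n) v → nbhdEdges G v ≡
      sumFin (λ u → count (λ w → (toℕ u <ᵇ toℕ w) ∧ adj G v u ∧ adj G v w ∧ adj G u w))
    nbhdEdges≡sumFin {suc n} G v
      with (λ (u : Fin n) → count (λ w →
             (toℕ (fsuc u) <ᵇ toℕ w) ∧ adj G v (fsuc u) ∧ adj G v w ∧ adj G (fsuc u) w))
         | count (λ w → (0 <ᵇ toℕ w) ∧ adj G v fzero ∧ adj G v w ∧ adj G fzero w)
    ... | f | a with suc n | G | v
    ...   | _ | G′ | v′ = cong (a +_) (hiddenSum≡sumFin G′ v′ f)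

  -- The clique number and the sparsity bound over the natural numbers.

  nC2 : ∀ m → 2 * (m C 2) + m ≡ m * m
  nC2 zero = refl
  nC2 (suc m) = begin
    2 * (suc m C 2) + suc m ≡⟨ cong (λ c → 2 * c + suc m) (nCk+nC[k+1]≡[n+1]C[k+1] m 1) ⟨
    2 * (m C 1 + m C 2) + suc m ≡⟨ cong (λ c → 2 * (c + m C 2) + suc m) (nC1≡n m) ⟩
    2 * (m + m C 2) + suc m ≡⟨ regroup m (m C 2) ⟩
    2 * (m C 2) + m + 2 * m + 1 ≡⟨ cong (λ x → x + 2 * m + 1) (nC2 m) ⟩
    m * m + 2 * m + 1 ≡⟨ square m ⟩
    suc m * suc m ∎
    where
    open ≡-Reasoning
    regroup : ∀ m c → 2 * (m + c) + suc m ≡ 2 * c + m + 2 * m + 1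
    regroup = solve-∀
    square : ∀ m → m * m + 2 * m + 1 ≡ suc m * suc m
    square = solve-∀

  module _ {n} (G : Graph n) where

    open import Data.List.Membership.DecPropositional (Fin._≟_ {n}) using (_∈?_)

    nbhdEdges≡pairs : ∀ v → nbhdEdges G v ≡ pairs (adj? G) (neighbours G v)
    nbhdEdges≡pairs v = trans (nbhdEdges≡sumFin G v) (sym (pairs-filter-tabulate {R = adj G} {f = adj G v} id))

    clique? : Decidable (IsClique G)
    clique? S = all? λ u → all? λ v →
      (S u Bool.≟ true) →-dec (S v Bool.≟ true) →-dec ¬? (u Fin.≟ v) →-dec adj? G u v

    -- The theorem bounds every clique number, so one has to be exhibited before that bound can be
    -- applied. The search descends from an upper bound until a clique attains it; finiteness makes
    -- each test decidable.
    cliqueNumber-below : ∀ w → (∀ S → IsClique G S → count S ≤ w) → ∃ (IsCliqueNumber G)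
    cliqueNumber-below zero bound = 0 , ((λ _ → false) , (λ _ _ ()) , n≤0⇒n≡0 (bound _ (λ _ _ ()))) , bound
    cliqueNumber-below (suc w) bound
      with anySubset? (λ S → clique? (lookup S) ×-dec (count (lookup S) ℕ.≟ suc w))
    ... | yes (S , found) = suc w , (lookup S , found) , bound
    ... | no none = cliqueNumber-below w λ S cl → ≤-pred (≤∧≢⇒< (bound S cl) λ eq →
      none (Vec.tabulate S ,
        (λ u v su sv → cl u v (trans (sym (lookup∘tabulate S u)) su) (trans (sym (lookup∘tabulate S v)) sv)) ,
        trans (count-cong (lookup∘tabulate S)) eq))

    cliqueNumber : ∃ (IsCliqueNumber G)
    cliqueNumber = cliqueNumber-below n (λ S _ → count≤ S)

    clique-length : ∀ {ω} → IsCliqueNumber G ω → ∀ {S} → Unique S → Clique G S → length S ≤ ω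
    clique-length {ω} (_ , bound) {S} uS cl = begin
      length S
        ≤⟨ Unique⇒length≤ uS (λ {u} u∈ →
             ∈-filter⁺ (λ u → χ u Bool.≟ true) (∈-allFin u) (dec-true (u ∈? S) u∈)) ⟩
      length (filter (λ u → χ u Bool.≟ true) (allFin n)) ≡⟨ length-filter-tabulate χ id ⟩
      count χ ≤⟨ bound χ (λ u v u∈ v∈ → cl (member u∈) (member v∈)) ⟩
      ω ∎
      where
      open ≤-Reasoning
      χ : Fin n → Bool
      χ u = does (u ∈? S)
      member : ∀ {u} → χ u ≡ true → u ∈ S
      member {u} eq with u ∈? S
      ... | yes u∈ = u∈

  -- e edges and T non-edges among d = deg v neighbours, c = C(Δ, 2), g = Δ − d.
  sparse-arithmetic : ∀ e d T c g b → 2 * (e + T) + d ≡ d * d → 2 * c + (d + g) ≡ (d + g) * (d + g) →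
    2 ≤ d + g → b ≤ d + g → (∀ {t} → b ≡ g + t → t * t ≤ 4 * T) → 4 * e + b * b ≤ 4 * c
  sparse-arithmetic e d T c g b eT eC 2≤Δ b≤Δ nonedges =
    +-cancelʳ-≤ (2 * (d + g)) _ _ (begin
      4 * e + b * b + 2 * (d + g) ≤⟨ +-cancelʳ-≤ (4 * T) _ _ (begin
        4 * e + b * b + 2 * (d + g) + 4 * T ≡⟨ regroup₁ e b d g T ⟩
        2 * (2 * (e + T) + d) + (b * b + 2 * g) ≡⟨ cong (λ x → 2 * x + (b * b + 2 * g)) eT ⟩
        2 * (d * d) + (b * b + 2 * g) ≤⟨ +-monoʳ-≤ (2 * (d * d)) key ⟩
        2 * (d * d) + (4 * (d * g) + 2 * (g * g) + 4 * T) ≡⟨ regroup₂ d g T ⟩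
        2 * ((d + g) * (d + g)) + 4 * T ∎) ⟩
      2 * ((d + g) * (d + g)) ≡⟨ cong (2 *_) eC ⟨
      2 * (2 * c + (d + g)) ≡⟨ regroup₃ c (d + g) ⟩
      4 * c + 2 * (d + g) ∎)
    where
    open ≤-Reasoning
    regroup₁ : ∀ e b d g T → 4 * e + b * b + 2 * (d + g) + 4 * T ≡ 2 * (2 * (e + T) + d) + (b * b + 2 * g)
    regroup₁ = solve-∀
    regroup₂ : ∀ d g T → 2 * (d * d) + (4 * (d * g) + 2 * (g * g) + 4 * T) ≡ 2 * ((d + g) * (d + g)) + 4 * T
    regroup₂ = solve-∀
    regroup₃ : ∀ c x → 2 * (2 * c + x) ≡ 4 * c + 2 * x
    regroup₃ = solve-∀
    -- This is what remains once `e` and `c` are eliminated. If `b < g`, the term `2 * (g * g)`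
    -- suffices. Otherwise `b = g + t`, the non-edges absorb `t * t`, and the rest has a common
    -- factor `g`, leaving an inequality that follows from `t ≤ d` and `2 ≤ d + g`.
    key : b * b + 2 * g ≤ 4 * (d * g) + 2 * (g * g) + 4 * T
    key with g ≤? b
    ... | no g≰b = begin
      b * b + 2 * g ≤⟨ +-monoˡ-≤ (2 * g) (*-monoʳ-≤ b (<⇒≤ b<g)) ⟩
      b * g + 2 * g ≡⟨ *-distribʳ-+ g b 2 ⟨
      (b + 2) * g ≤⟨ *-monoˡ-≤ g b+2≤2g ⟩
      2 * g * g ≡⟨ *-assoc 2 g g ⟩
      2 * (g * g) ≤⟨ m≤n+m _ (4 * (d * g)) ⟩
      4 * (d * g) + 2 * (g * g) ≤⟨ m≤m+n _ (4 * T) ⟩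
      4 * (d * g) + 2 * (g * g) + 4 * T ∎
      where
      b<g : b < g
      b<g = ≰⇒> g≰b
      b+2≤2g : b + 2 ≤ 2 * g
      b+2≤2g = begin
        b + 2 ≤⟨ +-monoˡ-≤ 2 (m≤n*m b 2) ⟩
        2 * b + 2 ≡⟨ trans (+-comm (2 * b) 2) (sym (*-suc 2 b)) ⟩
        2 * suc b ≤⟨ *-monoʳ-≤ 2 b<g ⟩
        2 * g ∎
    ... | yes g≤b with t , refl ← m≤n⇒∃[o]m+o≡n g≤b = begin
      (g + t) * (g + t) + 2 * g ≡⟨ expand g t ⟩
      g * (g + 2 * t + 2) + t * t ≤⟨ +-mono-≤ (*-monoʳ-≤ g bound) (nonedges refl) ⟩
      g * (4 * d + 2 * g) + 4 * T ≡⟨ collect d g T ⟩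
      4 * (d * g) + 2 * (g * g) + 4 * T ∎
      where
      expand : ∀ g t → (g + t) * (g + t) + 2 * g ≡ g * (g + 2 * t + 2) + t * t
      expand = solve-∀
      collect : ∀ d g T → g * (4 * d + 2 * g) + 4 * T ≡ 4 * (d * g) + 2 * (g * g) + 4 * T
      collect = solve-∀
      t≤d : t ≤ d
      t≤d = +-cancelʳ-≤ g t d (≤-trans (≤-reflexive (+-comm t g)) b≤Δ)
      bound : g + 2 * t + 2 ≤ 4 * d + 2 * g
      bound = begin
        g + 2 * t + 2 ≤⟨ +-mono-≤ (+-monoʳ-≤ g (*-monoʳ-≤ 2 t≤d)) 2≤Δ ⟩
        g + 2 * d + (d + g) ≤⟨ m≤m+n _ d ⟩
        g + 2 * d + (d + g) + d ≡⟨ sumUp d g ⟩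
        4 * d + 2 * g ∎
        where
        sumUp : ∀ d g → g + 2 * d + (d + g) + d ≡ 4 * d + 2 * g
        sumUp = solve-∀

  module _ {n} (G : Graph n) where

    -- The closed neighbourhood of `v` has `Δ + 1 - g` vertices, where `g = Δ - deg v`, so
    -- `square≤nonedges` applies to it with `t = b - g`. The vertex `v` is adjacent to all the
    -- others and adds no non-edge.
    nbhd-bound : ∀ {L} → IsCritical G L → ∀ {k s ω b} → IsKListAssignment L k → s + k ≡ suc (maxDegree G) →
      IsCliqueNumber G ω → ω + 2 * s + b ≡ suc (maxDegree G) → 2 ≤ maxDegree G →
      ∀ v → 4 * nbhdEdges G v + b * b ≤ 4 * (maxDegree G C 2)
    nbhd-bound crit {k} {s} {ω} {b} kL s+k isω b-def 2≤Δ v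
      with g , d+g ← m≤n⇒∃[o]m+o≡n (length-neighbours≤maxDegree G v) =
      sparse-arithmetic (nbhdEdges G v) d (pairs (nonadj? G) N) (maxDegree G C 2) g b
        (trans (cong (λ e → 2 * (e + pairs (nonadj? G) N) + d) (nbhdEdges≡pairs G v))
          (pairs-complement (adj? G) N))
        (subst (λ Δ → 2 * (maxDegree G C 2) + Δ ≡ Δ * Δ) (sym d+g) (nC2 (maxDegree G)))
        (subst (2 ≤_) (sym d+g) 2≤Δ)
        (subst (b ≤_) (sym d+g) b≤Δ)
        nonedges
      where
      N = neighbours G v
      d = length N
      -- The vertex `v` alone is a clique, so `ω` is at least 1.
      b≤Δ : b ≤ maxDegree G
      b≤Δ = ≤-pred (begin
        1 + b ≤⟨ +-monoˡ-≤ b (clique-length G isω {v ∷ []} ([] ∷ [])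
                   λ { (here refl) (here refl) v≢v → contradiction refl v≢v }) ⟩
        ω + b ≤⟨ +-monoˡ-≤ b (m≤m+n ω (2 * s)) ⟩
        ω + 2 * s + b ≡⟨ b-def ⟩
        suc (maxDegree G) ∎)
        where open ≤-Reasoning
      v∉N : ∀ {w} → w ∈ N → v ≢ w
      v∉N w∈ refl = nonadj-refl G (proj₂ (∈-filter⁻ (adj? G v) {xs = allFin n} w∈))
      v-full : pairs (nonadj? G) (v ∷ N) ≡ pairs (nonadj? G) N
      v-full = cong (λ xs → length xs + pairs (nonadj? G) N) (filter-none (nonadj? G v)
        (All.tabulate λ w∈ ¬vw → ¬vw (proj₂ (∈-filter⁻ (adj? G v) {xs = allFin n} w∈))))
      nonedges : ∀ {t} → b ≡ g + t → t * t ≤ 4 * pairs (nonadj? G) N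
      nonedges {t} refl = subst (λ T → t * t ≤ 4 * T) v-full
        (square≤nonedges G crit kL s+k (clique-length G isω) t
          (All.tabulate v∉N ∷ Unique-neighbours G v)
          (+-cancelʳ-≤ g _ _ (≤-reflexive (trans (regroup (ω + 2 * s) t g) (trans b-def (cong suc (sym d+g)))))))
        where
        regroup : ∀ a t g → a + t + g ≡ a + (g + t)
        regroup = solve-∀

    nbhdEdges-degree≤1 : maxDegree G ≤ 1 → ∀ v → nbhdEdges G v ≡ 0
    nbhdEdges-degree≤1 Δ≤1 v = trans (nbhdEdges≡pairs G v)
      (go (neighbours G v) (≤-trans (length-neighbours≤maxDegree G v) Δ≤1))
      where
      go : ∀ H → length H ≤ 1 → pairs (adj? G) H ≡ 0
      go [] _ = refl
      go (_ ∷ []) _ = refl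
      go (_ ∷ _ ∷ _) (s≤s ())

open Combinatorics using (nC2; cliqueNumber; nbhd-bound; nbhdEdges-degree≤1)

-- Arithmetic in an ordered field and the embedding of the natural numbers.

module Reals (R : RealField) where
  open RealField R

  *-zeroˡ : ∀ x → 0r * x ≡ 0r
  *-zeroˡ x = begin
    0r * x ≡⟨ +-idˡ (0r * x) ⟨
    0r + 0r * x ≡⟨ cong (_+ 0r * x) (+-invˡ (x * 0r)) ⟨
    (- (x * 0r) + x * 0r) + 0r * x ≡⟨ cong (λ y → (- (x * 0r) + x * 0r) + y) (*-comm 0r x) ⟩
    (- (x * 0r) + x * 0r) + x * 0r ≡⟨ +-assoc _ _ _ ⟩
    - (x * 0r) + (x * 0r + x * 0r) ≡⟨ cong (- (x * 0r) +_) (distribˡ x 0r 0r) ⟨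
    - (x * 0r) + x * (0r + 0r) ≡⟨ cong (λ y → - (x * 0r) + x * y) (+-idˡ 0r) ⟩
    - (x * 0r) + x * 0r ≡⟨ +-invˡ _ ⟩
    0r ∎
    where open ≡-Reasoning

  -- The solver works over this semiring: differences such as `1r - ε` enter as atoms and are
  -- cancelled by `sub-add`.
  commutativeSemiring : CommutativeSemiring _ _
  commutativeSemiring = record
    { Carrier = ℝ ; _≈_ = _≡_ ; _+_ = _+_ ; _*_ = _*_ ; 0# = 0r ; 1# = 1r
    ; isCommutativeSemiring = isCommutativeSemiringˡ record
      { +-isCommutativeMonoid = record
        { isMonoid = record
          { isSemigroup = record
            { isMagma = record { isEquivalence = isEquivalence ; ∙-cong = cong₂ _+_ }
            ; assoc = +-assoc }
          ; identity = +-idˡ , λ x → trans (+-comm x 0r) (+-idˡ x) }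
        ; comm = +-comm }
      ; *-isCommutativeMonoid = record
        { isMonoid = record
          { isSemigroup = record
            { isMagma = record { isEquivalence = isEquivalence ; ∙-cong = cong₂ _*_ }
            ; assoc = *-assoc }
          ; identity = *-idˡ , λ x → trans (*-comm x 1r) (*-idˡ x) }
        ; comm = *-comm }
      ; distribʳ = λ x y z → trans (*-comm (y + z) x)
          (trans (distribˡ x y z) (cong₂ _+_ (*-comm x y) (*-comm x z)))
      ; zeroˡ = *-zeroˡ
      }
    }
    where open import Algebra.Structures.Biased {A = ℝ} _≡_ using (isCommutativeSemiringˡ)

  open SemiringSolver commutativeSemiring using (Polynomial; solve; _:=_; _:+_; _:*_; con) public

  -- Evaluates to ι m definitionally, unlike con m.
  :ι : ∀ {n} → ℕ → Polynomial n
  :ι zero    = con 0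
  :ι (suc m) = con 1 :+ :ι m

  ≤-reflexive : ∀ {x y} → x ≡ y → x ≤ y
  ≤-reflexive refl = ≤-refl _

  poset : Poset _ _ _
  poset = record
    { Carrier = ℝ ; _≈_ = _≡_ ; _≤_ = _≤_
    ; isPartialOrder = record
      { isPreorder = record { isEquivalence = isEquivalence ; reflexive = ≤-reflexive ; trans = ≤-trans }
      ; antisym = ≤-antisym }
    }

  +-mono₂ : ∀ {x y u v} → x ≤ y → u ≤ v → x + u ≤ y + v
  +-mono₂ {x} {y} {u} {v} x≤y u≤v = ≤-trans (+-mono-≤ u x≤y)
    (subst₂ _≤_ (+-comm u y) (+-comm v y) (+-mono-≤ y u≤v))

  +-monoʳ : ∀ x {u v} → u ≤ v → x + u ≤ x + v
  +-monoʳ x = +-mono₂ (≤-refl x)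

  sub-add : ∀ x y → x - y + y ≡ x
  sub-add x y = trans (+-assoc x (- y) y) (trans (cong (x +_) (+-invˡ y)) (trans (+-comm x 0r) (+-idˡ x)))

  +-cancelʳ : ∀ {x y} z → x + z ≤ y + z → x ≤ y
  +-cancelʳ {x} {y} z le = subst₂ _≤_ (drop x) (drop y) (+-mono-≤ (- z) le)
    where
    drop : ∀ w → w + z + - z ≡ w
    drop w = trans (+-assoc w z (- z)) (trans (cong (w +_) (trans (+-comm z (- z)) (+-invˡ z)))
      (trans (+-comm w 0r) (+-idˡ w)))

  -- Totality stands in for halving: if `y ≤ x`, then `x + x ≤ y + y ≤ y + x`, and `x` cancels.
  double-cancel : ∀ {x y} → x + x ≤ y + y → x ≤ y
  double-cancel {x} {y} le with ≤-total x y
  ... | inj₁ x≤y = x≤y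
  ... | inj₂ y≤x = +-cancelʳ x (≤-trans le (+-monoʳ y y≤x))

  0≤sub : ∀ {x y} → x ≤ y → 0r ≤ y - x
  0≤sub {x} {y} x≤y = +-cancelʳ x (subst₂ _≤_ (sym (+-idˡ x)) (sym (sub-add y x)) x≤y)

  *-monoˡ : ∀ {x y z} → 0r ≤ z → x ≤ y → x * z ≤ y * z
  *-monoˡ {x} {y} {z} 0≤z x≤y = subst₂ _≤_ (+-idˡ _)
    (trans (solve 3 (λ d x z → d :* z :+ x :* z := (d :+ x) :* z) refl (y - x) x z) (cong (_* z) (sub-add y x)))
    (+-mono-≤ (x * z) (*-nonneg (0≤sub x≤y) 0≤z))

  0≤1 : 0r ≤ 1r
  0≤1 with ≤-total 0r 1r
  ... | inj₁ le = le
  ... | inj₂ 1≤0 = subst (0r ≤_) [-1]²≡1 (*-nonneg 0≤-1 0≤-1)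
    where
    0≤-1 : 0r ≤ 0r - 1r
    0≤-1 = 0≤sub 1≤0
    m = 0r - 1r
    m+1 : m + 1r ≡ 0r
    m+1 = sub-add 0r 1r
    [-1]²≡1 : m * m ≡ 1r
    [-1]²≡1 = begin
      m * m ≡⟨ +-idˡ _ ⟨
      0r + m * m ≡⟨ cong (_+ m * m) m+1 ⟨
      m + 1r + m * m ≡⟨ solve 1 (λ m → m :+ con 1 :+ m :* m := (m :+ con 1) :* m :+ con 1) refl m ⟩
      (m + 1r) * m + 1r ≡⟨ cong (λ x → x * m + 1r) m+1 ⟩
      0r * m + 1r ≡⟨ cong (_+ 1r) (*-zeroˡ m) ⟩
      0r + 1r ≡⟨ +-idˡ 1r ⟩
      1r ∎
      where open ≡-Reasoning

  0≤ι : ∀ m → 0r ≤ ι m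
  0≤ι zero = ≤-refl 0r
  0≤ι (suc m) = subst (_≤ 1r + ι m) (+-idˡ 0r) (+-mono₂ 0≤1 (0≤ι m))

  ι-+ : ∀ a b → ι (a ℕ.+ b) ≡ ι a + ι b
  ι-+ zero b = sym (+-idˡ (ι b))
  ι-+ (suc a) b = trans (cong (1r +_) (ι-+ a b)) (sym (+-assoc 1r (ι a) (ι b)))

  ι-* : ∀ a b → ι (a ℕ.* b) ≡ ι a * ι b
  ι-* zero b = sym (*-zeroˡ (ι b))
  ι-* (suc a) b = trans (ι-+ b (a ℕ.* b)) (trans (cong (ι b +_) (ι-* a b))
    (solve 2 (λ x y → y :+ x :* y := (con 1 :+ x) :* y) refl (ι a) (ι b)))

  ι-mono : ∀ {a b} → a ℕ.≤ b → ι a ≤ ι b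
  ι-mono {b = b} ℕ.z≤n = 0≤ι b
  ι-mono (ℕ.s≤s le) = +-monoʳ 1r (ι-mono le)

  ι-reflects : ∀ {a b} → ι a ≤ ι b → a ℕ.≤ b
  ι-reflects {a} {b} le with a ℕ.≤? b
  ... | yes a≤b = a≤b
  ... | no a≰b = contradiction (≤-antisym 0≤1 1≤0) 0≢1
    where
    1≤0 : 1r ≤ 0r
    1≤0 = +-cancelʳ (ι b) (≤-trans (ι-mono (ℕ.≰⇒> a≰b)) (≤-trans le (≤-reflexive (sym (+-idˡ (ι b))))))

  -- Since `δ` is half of β² and `2 c ≤ m²`, one has `4 δ c = β² (2 c) ≤ (β m)² ≤ b²`. Hence
  -- `4 e + 4 δ c ≤ 4 c`, and halving twice gives the claim.
  sparse-from-squares : ∀ {β δ} e c b m → 0r ≤ β → δ + δ ≡ β * β → β * ι m ≤ ι b →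
    2 ℕ.* c ℕ.≤ m ℕ.* m → 4 ℕ.* e ℕ.+ b ℕ.* b ℕ.≤ 4 ℕ.* c → ι e ≤ (1r - δ) * ι c
  sparse-from-squares {β} {δ} e c b m 0≤β 2δ βm≤b 2c≤m² 4e+b²≤4c =
    double-cancel (double-cancel (+-cancelʳ (ι 4 * (δ * ι c)) (begin
      ι e + ι e + (ι e + ι e) + ι 4 * (δ * ι c)
        ≡⟨ solve 3 (λ x δ c → x :+ x :+ (x :+ x) :+ :ι 4 :* (δ :* c) :=
             :ι 4 :* x :+ (δ :+ δ) :* (:ι 2 :* c)) refl (ι e) δ (ι c) ⟩
      ι 4 * ι e + (δ + δ) * (ι 2 * ι c)
        ≤⟨ +-monoʳ (ι 4 * ι e) 4δc≤b² ⟩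
      ι 4 * ι e + ι b * ι b
        ≡⟨ trans (ι-+ (4 ℕ.* e) (b ℕ.* b)) (cong₂ _+_ (ι-* 4 e) (ι-* b b)) ⟨
      ι (4 ℕ.* e ℕ.+ b ℕ.* b)
        ≤⟨ ι-mono 4e+b²≤4c ⟩
      ι (4 ℕ.* c)
        ≡⟨ ι-* 4 c ⟩
      ι 4 * ι c
        ≡⟨ cong (λ x → ι 4 * x) (trans (cong (_* ι c) (sub-add 1r δ)) (*-idˡ (ι c))) ⟨
      ι 4 * ((1r - δ + δ) * ι c)
        ≡⟨ solve 3 (λ θ δ c → :ι 4 :* ((θ :+ δ) :* c) :=
             θ :* c :+ θ :* c :+ (θ :* c :+ θ :* c) :+ :ι 4 :* (δ :* c)) refl (1r - δ) δ (ι c) ⟩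
      θc + θc + (θc + θc) + ι 4 * (δ * ι c) ∎)))
    where
    open PosetReasoning poset
    θc = (1r - δ) * ι c
    0≤βm : 0r ≤ β * ι m
    0≤βm = *-nonneg 0≤β (0≤ι m)
    4δc≤b² : (δ + δ) * (ι 2 * ι c) ≤ ι b * ι b
    4δc≤b² = begin
      (δ + δ) * (ι 2 * ι c) ≡⟨ cong (_* (ι 2 * ι c)) 2δ ⟩
      β * β * (ι 2 * ι c) ≡⟨ cong (β * β *_) (ι-* 2 c) ⟨
      β * β * ι (2 ℕ.* c) ≡⟨ *-comm _ _ ⟩
      ι (2 ℕ.* c) * (β * β) ≤⟨ *-monoˡ (*-nonneg 0≤β 0≤β) (ι-mono 2c≤m²) ⟩
      ι (m ℕ.* m) * (β * β) ≡⟨ cong (_* (β * β)) (ι-* m m) ⟩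
      ι m * ι m * (β * β) ≡⟨ solve 2 (λ β m → m :* m :* (β :* β) := β :* m :* (β :* m)) refl β (ι m) ⟩
      β * ι m * (β * ι m) ≤⟨ *-monoˡ 0≤βm βm≤b ⟩
      ι b * (β * ι m) ≡⟨ *-comm _ _ ⟩
      β * ι m * ι b ≤⟨ *-monoˡ (0≤ι b) βm≤b ⟩
      ι b * ι b ∎

-- Passing from the real parameters to the integer bound.

theorem1p5 : (R : RealField) → let open RealField R in
    (ε α : ℝ) → 0r < ε → 0r < α → ε + ε < α →
    ∀ {n} (G : Graph n) (L : ListAssignment n) →
    (∃ λ k → IsCeil k ((1r - ε) * ι (suc (maxDegree G))) × IsKListAssignment L k) →
    IsCritical G L →
    (∀ w → IsCliqueNumber G w → ι w ≤ (1r - α) * ι (suc (maxDegree G))) →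
    ∀ δ → δ + δ ≡ (α - (ε + ε)) * (α - (ε + ε)) →
    Sparse R G δ
theorem1p5 R ε α (0≤ε , _) _ (2ε≤α , _) G L (k , (k-above , k-least) , kL) crit ω-bound δ 2δ v
  with 2 ℕ.≤? maxDegree G
-- For Δ at most 1 the binomial coefficient vanishes, and so does the number of neighbourhood edges.
... | no Δ≱2 = subst₂ (λ e c → ι e ≤ (1r - δ) * ι c)
        (sym (nbhdEdges-degree≤1 G (ℕ.≤-pred (ℕ.≰⇒> Δ≱2)) v)) (sym (k>n⇒nCk≡0 (ℕ.≰⇒> Δ≱2)))
        (≤-reflexive (sym (trans (*-comm (1r - δ) 0r) (*-zeroˡ (1r - δ)))))
  where
  open RealField R
  open Reals R
... | yes 2≤Δ = sparse-from-squares (nbhdEdges G v) (maxDegree G C 2) b m 0≤β 2δ βm≤b 2c≤m²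
        (nbhd-bound G crit kL s+k isω b-def 2≤Δ v)
  where
  open RealField R
  open Reals R
  open PosetReasoning poset
  m = suc (maxDegree G)
  β = α - (ε + ε)
  0≤β : 0r ≤ β
  0≤β = 0≤sub 2ε≤α
  0≤βm : 0r ≤ β * ι m
  0≤βm = *-nonneg 0≤β (0≤ι m)
  split-m : (1r - ε) * ι m + ε * ι m ≡ ι m
  split-m = trans (solve 3 (λ η ε m → η :* m :+ ε :* m := (η :+ ε) :* m) refl (1r - ε) ε (ι m))
    (trans (cong (_* ι m) (sub-add 1r ε)) (*-idˡ (ι m)))
  -- Minimality of the ceiling is tested at `m` itself; thus `m ∸ k` is a true difference.
  k≤m : k ℕ.≤ m
  k≤m = k-least m (begin
    (1r - ε) * ι m ≡⟨ trans (+-comm _ 0r) (+-idˡ _) ⟨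
    (1r - ε) * ι m + 0r ≤⟨ +-monoʳ _ (*-nonneg 0≤ε (0≤ι m)) ⟩
    (1r - ε) * ι m + ε * ι m ≡⟨ split-m ⟩
    ι m ∎)
  s = m ℕ.∸ k
  s+k : s ℕ.+ k ≡ m
  s+k = ℕ.m∸n+n≡m k≤m
  s≤εm : ι s ≤ ε * ι m
  s≤εm = +-cancelʳ (ι k) (begin
    ι s + ι k ≡⟨ ι-+ s k ⟨
    ι (s ℕ.+ k) ≡⟨ cong ι s+k ⟩
    ι m ≡⟨ split-m ⟨
    (1r - ε) * ι m + ε * ι m ≤⟨ +-mono-≤ _ k-above ⟩
    ι k + ε * ι m ≡⟨ +-comm _ _ ⟩
    ε * ι m + ι k ∎)
  ω = proj₁ (cliqueNumber G)
  isω : IsCliqueNumber G ω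
  isω = proj₂ (cliqueNumber G)
  ι[ω+2s] : ι (ω ℕ.+ 2 ℕ.* s) ≡ ι ω + ι 2 * ι s
  ι[ω+2s] = trans (ι-+ ω (2 ℕ.* s)) (cong (ι ω +_) (ι-* 2 s))
  -- The coefficients of `m` sum to one: `1 - α` from `ω`, `2 ε` from `2 s`, and `β = α - 2 ε`. This
  -- leaves room for `b` to be at least `β m`.
  ω+2s+βm≤m : β * ι m + ι (ω ℕ.+ 2 ℕ.* s) ≤ ι m
  ω+2s+βm≤m = begin
    β * ι m + ι (ω ℕ.+ 2 ℕ.* s) ≡⟨ cong (β * ι m +_) ι[ω+2s] ⟩
    β * ι m + (ι ω + ι 2 * ι s)
      ≡⟨ solve 3 (λ x w s → x :+ (w :+ :ι 2 :* s) := x :+ (w :+ (s :+ s))) refl (β * ι m) (ι ω) (ι s) ⟩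
    β * ι m + (ι ω + (ι s + ι s)) ≤⟨ +-monoʳ _ (+-mono₂ (ω-bound ω isω) (+-mono₂ s≤εm s≤εm)) ⟩
    β * ι m + ((1r - α) * ι m + (ε * ι m + ε * ι m))
      ≡⟨ solve 4 (λ β ζ ε m → β :* m :+ (ζ :* m :+ (ε :* m :+ ε :* m)) :=
           (ζ :+ (β :+ (ε :+ ε))) :* m) refl β (1r - α) ε (ι m) ⟩
    (1r - α + (β + (ε + ε))) * ι m ≡⟨ cong (λ x → (1r - α + x) * ι m) (sub-add α (ε + ε)) ⟩
    (1r - α + α) * ι m ≡⟨ cong (_* ι m) (sub-add 1r α) ⟩
    1r * ι m ≡⟨ *-idˡ (ι m) ⟩
    ι m ∎
  ω+2s≤m : ω ℕ.+ 2 ℕ.* s ℕ.≤ m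
  ω+2s≤m = ι-reflects (begin
    ι (ω ℕ.+ 2 ℕ.* s) ≡⟨ +-idˡ _ ⟨
    0r + ι (ω ℕ.+ 2 ℕ.* s) ≤⟨ +-mono-≤ _ 0≤βm ⟩
    β * ι m + ι (ω ℕ.+ 2 ℕ.* s) ≤⟨ ω+2s+βm≤m ⟩
    ι m ∎)
  b = m ℕ.∸ (ω ℕ.+ 2 ℕ.* s)
  b-def : ω ℕ.+ 2 ℕ.* s ℕ.+ b ≡ m
  b-def = ℕ.m+[n∸m]≡n ω+2s≤m
  βm≤b : β * ι m ≤ ι b
  βm≤b = +-cancelʳ (ι (ω ℕ.+ 2 ℕ.* s)) (begin
    β * ι m + ι (ω ℕ.+ 2 ℕ.* s) ≤⟨ ω+2s+βm≤m ⟩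
    ι m ≡⟨ cong ι b-def ⟨
    ι (ω ℕ.+ 2 ℕ.* s ℕ.+ b) ≡⟨ ι-+ (ω ℕ.+ 2 ℕ.* s) b ⟩
    ι (ω ℕ.+ 2 ℕ.* s) + ι b ≡⟨ +-comm _ _ ⟩
    ι b + ι (ω ℕ.+ 2 ℕ.* s) ∎)
  2c≤m² : 2 ℕ.* (maxDegree G C 2) ℕ.≤ m ℕ.* m
  2c≤m² = ℕ.≤-trans (ℕ.m≤m+n _ (maxDegree G)) (ℕ.≤-trans (ℕ.≤-reflexive (nC2 (maxDegree G)))
    (ℕ.*-mono-≤ (ℕ.n≤1+n (maxDegree G)) (ℕ.n≤1+n (maxDegree G))))
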